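{- Let $0<q<1$, $n\ge1$, and let $\lambda,\mu$ be partitions with at most $n$ parts. Then \[ \sum_{T\in\mathrm{GT}_n(\lambda,\mu)}q^{|T|}=q^{|\mu|-b(\lambda)}\,s_\mu(q^{\delta_n})\,s_\lambda(q^{\mu+\delta_n})\prod_{j=1}^n\frac{(q;q)_{n-j}}{(q;q)_{\lambda_j+n-j}}, \] equivalently \[ \sum_{T\in\mathrm{GT}_n(\lambda,\mu)}q^{|T|}=\frac{q^{|\mu|-b(\delta_n+\lambda)}}{\prod_{j=1}^n(q;q)_{\lambda_j+n-j}}\,s_\lambda(q^{\mu+\delta_n})\,\overline\Delta(q^{\mu+\delta_n}). \]
   Context: An $(n,\lambda,\mu)$-Gelfand–Tsetlin pattern is an array $(x_{i,j})$ indexed by $1\le j\le n$, $1-\lambda_j\le i\le n+1-j$, of nonnegative integers such that $x_{i,j+1}\ge x_{i,j}\ge x_{i+1,j}$ whenever the indices involved lie in the index set, and $x_{i,n+1-i}=\mu_i$ for $1\le i\le n$; $\mathrm{GT}_n(\lambda,\mu)$ is the set of these and $|T|$ is the sum of entries. $\delta_n=(n-1,\dots,1,0)$, $b(\nu)=\sum_i(i-1)\nu_i$, $|\mu|=\sum\mu_i$, $q^{\nu}=(q^{\nu_1},\dots,q^{\nu_n})$. $s_\lambda(x_1,\dots,x_n)=\det(x_j^{\lambda_i+n-i})/\det(x_j^{n-i})$, $\overline\Delta(x)=\prod_{i<j}(x_j-x_i)$, $(q;q)_k=\prod_{l=1}^k(1-q^l)$.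
   Formalization: The number q with 0<q<1 is taken to be rational rather than real; the infinite sum over patterns is stated as the supremum of its finite partial sums, over the rationals. -}

module Defs where

open import Data.Nat as ℕ using (ℕ; zero; suc; _∸_; _≤_)
open import Data.Integer as ℤ using (ℤ; +_; -[1+_]; ∣_∣)
open import Data.Rational as ℚ using (ℚ; 0ℚ; 1ℚ; _*_; _-_; _<_; 1/_; ≢-nonZero)
open import Data.Rational.Properties using (_≟_)
open import Data.Fin using (Fin; punchIn; toℕ) renaming (zero to fz; suc to fs)
open import Data.List using (List; []; _∷_; length; map)
open import Data.Nat.ListAction using (sum)
open import Data.List.Relation.Unary.All using (All)
open import Data.List.Relation.Unary.Unique.Propositional using (Unique)
open import Data.Product using (_×_; Σ; ∃)
open import Relation.Binary.PropositionalEquality using (_≡_)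
open import Relation.Nullary using (yes; no)

infixr 8 _^ℚ_
_^ℚ_ : ℚ → ℕ → ℚ
q ^ℚ zero  = 1ℚ
q ^ℚ suc k = q * (q ^ℚ k)

-- total division: divQ p r = p / r when r ≠ 0, and 0 otherwise
-- (only ever applied to nonzero denominators below)
divQ : ℚ → ℚ → ℚ
divQ p r with r ≟ 0ℚ
... | yes _  = 0ℚ
... | no r≢0 = p * (1/_ r {{≢-nonZero r≢0}})

powZ : ℚ → ℤ → ℚ
powZ q (+ k)     = q ^ℚ k
powZ q -[1+ k ]  = divQ 1ℚ (q ^ℚ suc k)

prodR : ℕ → (ℕ → ℚ) → ℚ
prodR zero    f = 1ℚ
prodR (suc n) f = prodR n f * f (suc n)

sumN : ℕ → (ℕ → ℕ) → ℕ
sumN zero    f = 0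
sumN (suc n) f = sumN n f ℕ.+ f (suc n)

sumQ : List ℚ → ℚ
sumQ []       = 0ℚ
sumQ (x ∷ xs) = x ℚ.+ sumQ xs

det : (n : ℕ) → (Fin n → Fin n → ℚ) → ℚ
det zero    M = 1ℚ
det (suc n) M = go (suc n) (λ k → k)
  where
  sgn : ℕ → ℚ
  sgn zero          = 1ℚ
  sgn (suc zero)    = ℚ.- 1ℚ
  sgn (suc (suc k)) = sgn k
  term : Fin (suc n) → ℚ
  term k = sgn (toℕ k) * M fz k * det n (λ i j → M (fs i) (punchIn k j))
  go : (m : ℕ) → (Fin m → Fin (suc n)) → ℚ
  go zero    ι = 0ℚ
  go (suc m) ι = term (ι fz) ℚ.+ go m (λ k → ι (fs k))

-- Notions from the paper (indices are 1-based; sequences are ℕ → ℕ / ℕ → ℚ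
-- and only the values at 1..n matter)

IsPartition : ℕ → (ℕ → ℕ) → Set
IsPartition n lam = ∀ i → 1 ≤ i → suc i ≤ n → lam (suc i) ≤ lam i

schur : (n : ℕ) → (ℕ → ℕ) → (ℕ → ℚ) → ℚ
schur n lam x =
  divQ (det n (λ i j → x (suc (toℕ j)) ^ℚ (lam (suc (toℕ i)) ℕ.+ n ∸ suc (toℕ i))))
       (det n (λ i j → x (suc (toℕ j)) ^ℚ (n ∸ suc (toℕ i))))

vandBar : ℕ → (ℕ → ℚ) → ℚ
vandBar n x = prodR n (λ j → prodR (j ∸ 1) (λ i → x j - x i))

qPoch : ℚ → ℕ → ℚ
qPoch q k = prodR k (λ l → 1ℚ - q ^ℚ l)

bStat : ℕ → (ℕ → ℕ) → ℕ
bStat n ν = sumN n (λ i → (i ∸ 1) ℕ.* ν i)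

size : ℕ → (ℕ → ℕ) → ℕ
size n ν = sumN n ν

delta : ℕ → ℕ → ℕ
delta n i = n ∸ i

addSeq : (ℕ → ℕ) → (ℕ → ℕ) → ℕ → ℕ
addSeq a b i = a i ℕ.+ b i

qPow : ℚ → (ℕ → ℕ) → ℕ → ℚ
qPow q ν i = q ^ℚ ν i

-- Gelfand–Tsetlin patterns.
-- A pattern is stored as the list of its columns j = 1..n; column j lists
-- x_{i,j} for i = 1-λ_j, …, n+1-j (in this order), so it has n-j+λ_j+1 entries.

nthD : List ℕ → ℕ → ℕ
nthD []       _       = 0
nthD (x ∷ xs) zero    = x
nthD (x ∷ xs) (suc k) = nthD xs k

nthL : List (List ℕ) → ℕ → List ℕ
nthL []       _       = []
nthL (c ∷ cs) zero    = c
nthL (c ∷ cs) (suc k) = nthL cs k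

InIdx : ℕ → (ℕ → ℕ) → ℤ → ℕ → Set
InIdx n lam i j = (1 ≤ j) × (j ≤ n) × ((+ 1 ℤ.- + lam j) ℤ.≤ i) × (i ℤ.≤ + (n ℕ.+ 1 ∸ j))

entry : (ℕ → ℕ) → List (List ℕ) → ℤ → ℕ → ℕ
entry lam T i j = nthD (nthL T (j ∸ 1)) ∣ i ℤ.+ + lam j ℤ.- + 1 ∣

IsGT : ℕ → (ℕ → ℕ) → (ℕ → ℕ) → List (List ℕ) → Set
IsGT n lam mu T =
  (length T ≡ n)
  × (∀ j → 1 ≤ j → j ≤ n → length (nthL T (j ∸ 1)) ≡ (n ∸ j) ℕ.+ lam j ℕ.+ 1)
  × (∀ i j → InIdx n lam i j → InIdx n lam i (suc j) →
        entry lam T i j ≤ entry lam T i (suc j))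
  × (∀ i j → InIdx n lam i j → InIdx n lam (i ℤ.+ + 1) j →
        entry lam T (i ℤ.+ + 1) j ≤ entry lam T i j)
  × (∀ i → 1 ≤ i → i ≤ n → entry lam T (+ i) (n ℕ.+ 1 ∸ i) ≡ mu i)

weight : List (List ℕ) → ℕ
weight T = sum (map sum T)

-- Σ_{T ∈ GT_n(λ,μ)} q^{|T|} = R, for 0<q, as a series of positive terms:
-- every finite sum of distinct terms is ≤ R, and finite sums come within any ε of R.
SumGT : ℚ → ℕ → (ℕ → ℕ) → (ℕ → ℕ) → ℚ → Set
SumGT q n lam mu R =
  (∀ (L : List (List (List ℕ))) → Unique L → All (IsGT n lam mu) L →
     sumQ (map (λ T → q ^ℚ weight T) L) ℚ.≤ R)
  × (∀ (ε : ℚ) → 0ℚ < ε → Σ (List (List (List ℕ))) λ L →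
       Unique L × All (IsGT n lam mu) L ×
       (R - ε < sumQ (map (λ T → q ^ℚ weight T) L)))

rhs1 : ℚ → ℕ → (ℕ → ℕ) → (ℕ → ℕ) → ℚ
rhs1 q n lam mu =
  powZ q (+ size n mu ℤ.- + bStat n lam)
  * schur n mu (qPow q (delta n))
  * schur n lam (qPow q (addSeq mu (delta n)))
  * prodR n (λ j → divQ (qPoch q (n ∸ j)) (qPoch q (lam j ℕ.+ n ∸ j)))

rhs2 : ℚ → ℕ → (ℕ → ℕ) → (ℕ → ℕ) → ℚ
rhs2 q n lam mu =
  divQ (powZ q (+ size n mu ℤ.- + bStat n (addSeq (delta n) lam)))
       (prodR n (λ j → qPoch q (lam j ℕ.+ n ∸ j)))
  * schur n lam (qPow q (addSeq mu (delta n)))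
  * vandBar n (qPow q (addSeq mu (delta n)))

{-# OPTIONS --safe #-}
module Submission where

-- Removing the diagonal x_{i,n+1-i} = μ_i from a pattern leaves a pattern for λ - 1 whose
-- diagonal ν interlaces μ; if λ_n = 0 the last column disappears, and otherwise ν₁ is unbounded.
-- So the sum satisfies a recursion over ν.  Up to an explicit factor its solution is the
-- determinant of the matrix with entries q^{(μ_{n-a} + a) l_b}, l_b = λ_b + n - b: summing each
-- row of the smaller determinant over its interval gives telescoping geometric sums, that is,
-- differences of adjacent rows of a determinant with one more row and a column of ones.  The
-- unbounded case is the limit N → ∞ of the bounded one with an extra part N, whose row tends to
-- (0, …, 0, 1).  Vandermonde's formula then turns the determinant into the two products.

open import Defs
open import Data.Nat as ℕ using (ℕ; zero; suc; _∸_; z≤n; s≤s; s≤s⁻¹)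
open import Data.Nat.ListAction using () renaming (sum to total)
open import Data.Fin using (Fin; punchIn; toℕ; zero; suc; inject₁; fromℕ; opposite)
open import Data.List using (List; []; _∷_; _++_; map; length; reverse; take; drop; filter; deduplicate;
  applyUpTo; cartesianProductWith)
open import Data.List.Properties using (length-map; length-++; length-take; length-reverse; length-applyUpTo;
  unfold-reverse; reverse-involutive; ∷-injective; ≡-dec)
open import Data.List.Relation.Unary.All as All using (All; []; _∷_)
open import Data.List.Relation.Unary.Any using (here; there)
open import Data.List.Relation.Unary.AllPairs using ([]; _∷_)
open import Data.List.Relation.Unary.Unique.Propositional using (Unique)
open import Data.List.Membership.Propositional using (_∈_)
open import Data.List.Membership.Propositional.Properties
open import Data.Product using (Σ; ∃; _×_; _,_; proj₁; proj₂)
open import Data.Sum using (inj₁; inj₂)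
open import Data.Empty using (⊥-elim)
open import Relation.Nullary using (¬_; yes; no; ¬?)
open import Relation.Unary using (Decidable)
open import Relation.Binary using (DecidableEquality)
open import Relation.Binary.PropositionalEquality hiding ([_])
import Data.List.Relation.Unary.All.Properties as All
import Data.List.Relation.Unary.Unique.Propositional.Properties as Unique

-- Patterns and interlacing sequences

-- Over the rationals the sum cannot be defined as a limit and evaluated afterwards. The closed form
-- `value` has to be known beforehand, and the induction shows that it bounds all finite sums and is
-- approached by them. Since ν₁ may be unbounded, the recursion adds up infinitely many infinite
-- sums; this is the purpose of `hasSum-by-fibres` and `hasSum-by-exhaustion`.
--
-- The strictly decreasing sequence l replaces λ because it makes the two cases of the recursion
-- alike. If λ_n > 0, removing the diagonal leaves n columns and λ - 1; if λ_n = 0, it leaves n - 1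
-- columns and the other parts of λ unchanged. In both cases the remaining columns carry l - 1, and
-- a column disappears exactly when its l is 0.
--
-- With b counted from 0, the explicit factor is q^|μ| divided by the product of q^(b l_b)
-- (q;q)_(l_b). The recursion forces it: lowering every l_b by one takes from the denominator the
-- powers of q that come out of the rows of the determinant and the factors 1 - q^(l_b) that the
-- geometric sums require.

module Combinatorics where
  open import Data.Nat using (_+_; _≤_; _<_; _<?_)
  open import Data.Nat.Properties

  n∸i≡suc : ∀ {n i} → i < n → n ∸ i ≡ suc (n ∸ suc i)
  n∸i≡suc i<n = +-∸-assoc 1 i<n

  interval : ℕ → ℕ → List ℕ
  interval x y = applyUpTo (x +_) (suc y ∸ x)

  -- The case in which every entry is bounded on both sides. The form as an iterated product of
  -- intervals is what `det-interlacing` uses.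
  interlacing : List ℕ → List (List ℕ)
  interlacing []          = []
  interlacing (x ∷ [])    = [] ∷ []
  interlacing (x ∷ y ∷ μ) = cartesianProductWith _∷_ (interval x y) (interlacing (y ∷ μ))

  Ascending : List ℕ → Set
  Ascending μ = ∀ a → suc a < length μ → nthD μ a ≤ nthD μ (suc a)

  cell : List (List ℕ) → ℕ → ℕ → ℕ
  cell T a p = nthD (nthL T a) p

  bottom : List (List ℕ) → List ℕ
  bottom = map (λ c → nthD c 0)

  -- Columns are read from the left and, unlike in the statement, from the bottom upwards: cell T a p
  -- is x_{i,j} with j = a + 1 and i = n + 1 - j - p, and l a = λ_j + n - j.
  record Pattern (n : ℕ) (l : ℕ → ℕ) (μ : List ℕ) (T : List (List ℕ)) : Set where
    field
      columns    : length T ≡ n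
      heights    : ∀ a → a < n → length (nthL T a) ≡ suc (l a)
      vertical   : ∀ a p → a < n → p < l a → cell T a p ≤ cell T a (suc p)
      horizontal : ∀ a p → suc a < n → p ≤ l (suc a) → cell T a (suc p) ≤ cell T (suc a) p
      base       : bottom T ≡ μ

  -- Covers both cases of the recursion: for `n ≡ suc m` every entry of `ν` has an upper bound, and
  -- for `n ≡ m` the last and largest one has none.
  record Interlaces (m n : ℕ) (μ ν : List ℕ) : Set where
    field
      length≡ : length ν ≡ m
      lower : ∀ a → a < m → nthD μ a ≤ nthD ν a
      upper : ∀ a → a < m → suc a < n → nthD ν a ≤ nthD μ (suc a)

  nthD-bottom : ∀ T a → nthD (bottom T) a ≡ cell T a 0
  nthD-bottom []      a       = refl
  nthD-bottom (c ∷ T) zero    = refl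
  nthD-bottom (c ∷ T) (suc a) = nthD-bottom T a

  nthL-beyond : ∀ T a → length T ≤ a → nthL T a ≡ []
  nthL-beyond []      a       _       = refl
  nthL-beyond (c ∷ T) (suc a) (s≤s h) = nthL-beyond T a h

  nthL-ext : ∀ T T′ → length T ≡ length T′ → (∀ a → a < length T → nthL T a ≡ nthL T′ a) → T ≡ T′
  nthL-ext []      []        _ _ = refl
  nthL-ext (c ∷ T) (c′ ∷ T′) e h =
    cong₂ _∷_ (h 0 (s≤s z≤n)) (nthL-ext T T′ (suc-injective e) (λ a a< → h (suc a) (s≤s a<)))

  -- A missing column counts as empty: when the last column of the result is its diagonal cell
  -- alone, `T` has one column less than `μ` has entries.
  glue : List ℕ → List (List ℕ) → List (List ℕ)
  glue []      T       = []
  glue (x ∷ μ) []      = (x ∷ []) ∷ glue μ []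
  glue (x ∷ μ) (c ∷ T) = (x ∷ c) ∷ glue μ T

  peel : ℕ → List (List ℕ) → List (List ℕ)
  peel m T = take m (map (drop 1) T)

  length-glue : ∀ μ T → length (glue μ T) ≡ length μ
  length-glue []      T       = refl
  length-glue (x ∷ μ) []      = cong suc (length-glue μ [])
  length-glue (x ∷ μ) (c ∷ T) = cong suc (length-glue μ T)

  bottom-glue : ∀ μ T → bottom (glue μ T) ≡ μ
  bottom-glue []      T       = refl
  bottom-glue (x ∷ μ) []      = cong (x ∷_) (bottom-glue μ [])
  bottom-glue (x ∷ μ) (c ∷ T) = cong (x ∷_) (bottom-glue μ T)

  weight-glue : ∀ μ T → length T ≤ length μ → weight (glue μ T) ≡ total μ + weight T
  weight-glue []      []      _       = refl
  weight-glue (x ∷ μ) []      _       = trans (cong (x + 0 +_) (weight-glue μ [] z≤n))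
    (trans (cong (_+ (total μ + 0)) (+-identityʳ x)) (sym (+-assoc x (total μ) 0)))
  weight-glue (x ∷ μ) (c ∷ T) (s≤s h) = trans (cong (x + total c +_) (weight-glue μ T h)) (interchange x (total c) (total μ) (weight T))
    where
    interchange : ∀ a b c d → a + b + (c + d) ≡ a + c + (b + d)
    interchange a b c d = trans (+-assoc a b (c + d)) (trans (cong (a +_) (trans (sym (+-assoc b c d))
      (trans (cong (_+ d) (+-comm b c)) (+-assoc c b d)))) (sym (+-assoc a c (b + d))))

  nthL-glue : ∀ μ T a → a < length μ → nthL (glue μ T) a ≡ nthD μ a ∷ nthL T a
  nthL-glue (x ∷ μ) []      zero    _       = refl
  nthL-glue (x ∷ μ) (c ∷ T) zero    _       = refl
  nthL-glue (x ∷ μ) []      (suc a) (s≤s h) = nthL-glue μ [] a h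
  nthL-glue (x ∷ μ) (c ∷ T) (suc a) (s≤s h) = nthL-glue μ T a h

  nthL-peel : ∀ m T a → a < m → nthL (peel m T) a ≡ drop 1 (nthL T a)
  nthL-peel (suc m) []      a       _       = refl
  nthL-peel (suc m) (c ∷ T) zero    _       = refl
  nthL-peel (suc m) (c ∷ T) (suc a) (s≤s h) = nthL-peel m T a h

  nthD-drop : ∀ c p → nthD (drop 1 c) p ≡ nthD c (suc p)
  nthD-drop []      p = refl
  nthD-drop (x ∷ c) p = refl

  cell-peel : ∀ m T a p → a < m → cell (peel m T) a p ≡ cell T a (suc p)
  cell-peel m T a p a<m = trans (cong (λ c → nthD c p) (nthL-peel m T a a<m)) (nthD-drop (nthL T a) p)

  peel-glue : ∀ m μ T → length T ≡ m → m ≤ length μ → peel m (glue μ T) ≡ T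
  peel-glue zero    μ       []      _ _       = refl
  peel-glue (suc m) (x ∷ μ) (c ∷ T) e (s≤s h) = cong (c ∷_) (peel-glue m μ T (suc-injective e) h)

  ∷-of-length : ∀ c {k} → length c ≡ suc k → c ≡ nthD c 0 ∷ drop 1 c
  ∷-of-length (x ∷ c) _ = refl

  drop-length : ∀ (c : List ℕ) {k} → length c ≡ suc k → length (drop 1 c) ≡ k
  drop-length (x ∷ c) e = suc-injective e

  -- m is the number of columns left after the bottom row has been removed.
  module Layer (m n : ℕ) (l : ℕ → ℕ) (μ : List ℕ) (|μ| : length μ ≡ n) (m≤n : m ≤ n) (n≤1+m : n ≤ suc m)
               (tall : ∀ {a} → a < m → 1 ≤ l a) (short : ∀ {a} → m ≤ a → a < n → l a ≡ 0) where

    open Pattern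
    open Interlaces

    l′ : ℕ → ℕ
    l′ a = l a ∸ 1

    -- The new diagonal is read off from `T` instead of being a parameter, so that `glue` and `peel`
    -- are bijections of whole families. The sum over ν arises later from the fibres of `bottom`.
    Inner : List (List ℕ) → Set
    Inner T = Pattern m l′ (bottom T) T × Interlaces m n μ (bottom T)

    inside : ∀ {a} → a < n → 1 ≤ l a → a < m
    inside {a} a<n 1≤l = ≰⇒> (λ m≤a → <⇒≱ 1≤l (≤-reflexive (short m≤a a<n)))

    suc-l′ : ∀ {a} → a < m → suc (l′ a) ≡ l a
    suc-l′ a<m = m+[n∸m]≡n (tall a<m)

    -- Inequalities that involve the new bottom cells are the interlacing conditions; all others are
    -- those of `T`, shifted by one cell.
    glue-pattern : ∀ {T} → Inner T → Pattern n l μ (glue μ T)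
    glue-pattern {T} (pat , int) = record
      { columns    = trans (length-glue μ T) |μ|
      ; heights    = heights′
      ; vertical   = vertical′
      ; horizontal = horizontal′
      ; base       = bottom-glue μ T
      }
      where
      column : ∀ {a} → a < n → nthL (glue μ T) a ≡ nthD μ a ∷ nthL T a
      column {a} a<n = nthL-glue μ T a (subst (a <_) (sym |μ|) a<n)

      heights′ : ∀ a → a < n → length (nthL (glue μ T) a) ≡ suc (l a)
      heights′ a a<n with a <? m
      ... | yes a<m = trans (cong length (column a<n)) (cong suc (trans (heights pat a a<m) (suc-l′ a<m)))
      ... | no  a≮m = trans (cong length (trans (column a<n)
              (cong (nthD μ a ∷_) (nthL-beyond T a (subst (_≤ a) (sym (columns pat)) (≮⇒≥ a≮m))))))
              (cong suc (sym (short (≮⇒≥ a≮m) a<n)))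

      vertical′ : ∀ a p → a < n → p < l a → cell (glue μ T) a p ≤ cell (glue μ T) a (suc p)
      vertical′ a p a<n p<l rewrite column a<n with p
      ... | zero  = subst (nthD μ a ≤_) (nthD-bottom T a) (lower int a (inside a<n p<l))
      ... | suc r = vertical pat a r (inside a<n (≤-trans (s≤s z≤n) p<l)) (∸-monoˡ-≤ 1 p<l)

      horizontal′ : ∀ a p → suc a < n → p ≤ l (suc a) → cell (glue μ T) a (suc p) ≤ cell (glue μ T) (suc a) p
      horizontal′ a p 1+a<n p≤l rewrite column (<-trans (n<1+n a) 1+a<n) | column 1+a<n with p
      ... | zero  = subst (_≤ nthD μ (suc a)) (nthD-bottom T a) (upper int a (s≤s⁻¹ (≤-trans 1+a<n n≤1+m)) 1+a<n)
      ... | suc r = horizontal pat a r (inside 1+a<n (≤-trans (s≤s z≤n) p≤l)) (∸-monoˡ-≤ 1 p≤l)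

    peel-inner : ∀ {T} → Pattern n l μ T → Inner (peel m T)
    peel-inner {T} pat = record
      { columns    = columns′
      ; heights    = λ a a<m → trans (cong length (nthL-peel m T a a<m))
                       (trans (drop-length (nthL T a) (heights pat a (<-≤-trans a<m m≤n))) (sym (suc-l′ a<m)))
      ; vertical   = λ a p a<m p<l′ → subst₂ _≤_ (sym (cell-peel m T a p a<m)) (sym (cell-peel m T a (suc p) a<m))
                       (vertical pat a (suc p) (<-≤-trans a<m m≤n) (subst (suc p <_) (suc-l′ a<m) (s≤s p<l′)))
      ; horizontal = λ a p 1+a<m p≤l′ → subst₂ _≤_
                       (sym (cell-peel m T a (suc p) (<-trans (n<1+n a) 1+a<m))) (sym (cell-peel m T (suc a) p 1+a<m))
                       (horizontal pat a (suc p) (<-≤-trans 1+a<m m≤n) (subst (suc p ≤_) (suc-l′ 1+a<m) (s≤s p≤l′)))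
      ; base       = refl
      } , record
      { length≡ = trans (length-map _ (peel m T)) columns′
      ; lower = λ a a<m → subst₂ _≤_ (μ-cell a) (sym (ν-cell a a<m))
                  (vertical pat a 0 (<-≤-trans a<m m≤n) (tall a<m))
      ; upper = λ a a<m 1+a<n → subst₂ _≤_ (sym (ν-cell a a<m)) (μ-cell (suc a))
                  (horizontal pat a 0 1+a<n z≤n)
      }
      where
      columns′ : length (peel m T) ≡ m
      columns′ = trans (length-take m (map (drop 1) T))
        (m≤n⇒m⊓n≡m (subst (m ≤_) (sym (trans (length-map (drop 1) T) (columns pat))) m≤n))

      μ-cell : ∀ a → cell T a 0 ≡ nthD μ a
      μ-cell a = trans (sym (nthD-bottom T a)) (cong (λ ν → nthD ν a) (base pat))

      ν-cell : ∀ a → a < m → nthD (bottom (peel m T)) a ≡ cell T a 1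
      ν-cell a a<m = trans (nthD-bottom (peel m T) a) (cell-peel m T a 0 a<m)

    glue-peel : ∀ {T} → Pattern n l μ T → glue μ (peel m T) ≡ T
    glue-peel {T} pat = nthL-ext (glue μ (peel m T)) T
      (trans (length-glue μ (peel m T)) (trans |μ| (sym (columns pat))))
      (λ a a< → let a<μ = subst (a <_) (length-glue μ (peel m T)) a<
                    a<n = subst (a <_) |μ| a<μ
                in trans (nthL-glue μ (peel m T) a a<μ) (trans (cong₂ _∷_ (head a) (tail a a<n))
                     (sym (∷-of-length (nthL T a) (heights pat a a<n)))))
      where
      head : ∀ a → nthD μ a ≡ cell T a 0
      head a = trans (cong (λ ν → nthD ν a) (sym (base pat))) (nthD-bottom T a)

      tail : ∀ a → a < n → nthL (peel m T) a ≡ drop 1 (nthL T a)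
      tail a a<n with a <? m
      ... | yes a<m = nthL-peel m T a a<m
      ... | no  a≮m = trans
        (nthL-beyond (peel m T) a (subst (_≤ a) (sym (columns (proj₁ (peel-inner pat)))) (≮⇒≥ a≮m)))
        (sym (empty (drop 1 (nthL T a)) (trans (drop-length (nthL T a) (heights pat a a<n)) (short (≮⇒≥ a≮m) a<n))))
        where
        empty : ∀ (c : List ℕ) → length c ≡ 0 → c ≡ []
        empty [] _ = refl

  ∈-interval⁺ : ∀ {x y z} → x ≤ z → z ≤ y → z ∈ interval x y
  ∈-interval⁺ {x} {y} {z} x≤z z≤y = subst (_∈ interval x y) (m+[n∸m]≡n x≤z)
    (∈-applyUpTo⁺ (x +_) (subst (suc (z ∸ x) ≤_) (sym (+-∸-assoc 1 (≤-trans x≤z z≤y))) (s≤s (∸-monoˡ-≤ x z≤y))))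

  ∈-interval⁻ : ∀ {x y z} → x ≤ y → z ∈ interval x y → x ≤ z × z ≤ y
  ∈-interval⁻ {x} {y} x≤y z∈ with ∈-applyUpTo⁻ (x +_) z∈
  ... | i , i< , refl = m≤m+n x i ,
    subst (x + i ≤_) (m+[n∸m]≡n x≤y) (+-monoʳ-≤ x (s≤s⁻¹ (subst (i <_) (+-∸-assoc 1 x≤y) i<)))

  interval-unique : ∀ x y → Unique (interval x y)
  interval-unique x y = Unique.applyUpTo⁺₁ (x +_) (suc y ∸ x) (λ i<j _ e → <⇒≢ i<j (+-cancelˡ-≡ x _ _ e))

  interlacing-unique : ∀ μ → Unique (interlacing μ)
  interlacing-unique []          = []
  interlacing-unique (x ∷ [])    = [] ∷ []
  interlacing-unique (x ∷ y ∷ μ) =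
    Unique.cartesianProductWith⁺ _∷_ ∷-injective (interval-unique x y) (interlacing-unique (y ∷ μ))

  ∈-interlacing⁺ : ∀ {m} μ ν → length μ ≡ suc m → Interlaces m (suc m) μ ν → ν ∈ interlacing μ
  ∈-interlacing⁺ (x ∷ [])    []      refl int = here refl
  ∈-interlacing⁺ (x ∷ [])    (z ∷ ν) refl int with () ← Interlaces.length≡ int
  ∈-interlacing⁺ (x ∷ y ∷ μ) []      refl int with () ← Interlaces.length≡ int
  ∈-interlacing⁺ (x ∷ y ∷ μ) (z ∷ ν) refl int = ∈-cartesianProductWith⁺ _∷_
    (∈-interval⁺ (lower 0 (s≤s z≤n)) (upper 0 (s≤s z≤n) (s≤s (s≤s z≤n))))
    (∈-interlacing⁺ (y ∷ μ) ν refl (record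
      { length≡ = suc-injective length≡
      ; lower = λ a a< → lower (suc a) (s≤s a<)
      ; upper = λ a a< 1+a< → upper (suc a) (s≤s a<) (s≤s 1+a<) }))
    where open Interlaces int

  ∈-interlacing⁻ : ∀ {m} μ {ν} → length μ ≡ suc m → Ascending μ → ν ∈ interlacing μ → Interlaces m (suc m) μ ν
  ∈-interlacing⁻ (x ∷ [])    refl asc (here refl) = record { length≡ = refl ; lower = λ _ () ; upper = λ _ () }
  ∈-interlacing⁻ (x ∷ y ∷ μ) refl asc ν∈ with ∈-cartesianProductWith⁻ _∷_ (interval x y) (interlacing (y ∷ μ)) ν∈
  ... | z , ν , z∈ , ν∈′ , refl = record
    { length≡ = cong suc length≡
    ; lower = λ { zero _ → proj₁ z-bounds ; (suc a) (s≤s a<) → lower a a< }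
    ; upper = λ { zero _ _ → proj₂ z-bounds ; (suc a) (s≤s a<) (s≤s 1+a<) → upper a a< 1+a< } }
    where
    z-bounds = ∈-interval⁻ (asc 0 (s≤s (s≤s z≤n))) z∈
    open Interlaces (∈-interlacing⁻ (y ∷ μ) refl (λ a a< → asc (suc a) (s≤s a<)) ν∈′)

  nthD-≤-total : ∀ μ a → nthD μ a ≤ total μ
  nthD-≤-total []      a       = z≤n
  nthD-≤-total (x ∷ μ) zero    = m≤m+n x (total μ)
  nthD-≤-total (x ∷ μ) (suc a) = ≤-trans (nthD-≤-total μ a) (m≤n+m (total μ) x)

  nthD-++ˡ : ∀ μ ν a → a < length μ → nthD (μ ++ ν) a ≡ nthD μ a
  nthD-++ˡ (x ∷ μ) ν zero    _       = refl
  nthD-++ˡ (x ∷ μ) ν (suc a) (s≤s h) = nthD-++ˡ μ ν a h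

  nthD-++-last : ∀ μ x → nthD (μ ++ x ∷ []) (length μ) ≡ x
  nthD-++-last []      x = refl
  nthD-++-last (y ∷ μ) x = nthD-++-last μ x

  ascending-++ : ∀ μ x → Ascending μ → (∀ a → nthD μ a ≤ x) → Ascending (μ ++ x ∷ [])
  ascending-++ μ x asc μ≤x a a< with suc a <? length μ
  ... | yes 1+a<μ = subst₂ _≤_ (sym (nthD-++ˡ μ _ a (<-trans (n<1+n a) 1+a<μ))) (sym (nthD-++ˡ μ _ (suc a) 1+a<μ)) (asc a 1+a<μ)
  ... | no  1+a≮μ = subst₂ _≤_ (sym (nthD-++ˡ μ _ a (≤-reflexive 1+a≡)))
                      (sym (trans (cong (nthD (μ ++ x ∷ [])) 1+a≡) (nthD-++-last μ x))) (μ≤x a)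
    where
    1+a≡ : suc a ≡ length μ
    1+a≡ = ≤-antisym (s≤s⁻¹ (subst (suc a <_) (trans (length-++ μ) (+-comm (length μ) 1)) a<)) (≮⇒≥ 1+a≮μ)

open Combinatorics

open import Level using (0ℓ)
open import Data.Integer as ℤ using (ℤ; -[1+_])
open import Data.Rational using (ℚ; 0ℚ; 1ℚ; ½; -_; _+_; _*_; _-_; 1/_; _<_; _≤_; ∣_∣; mkℚ; toℚᵘ; NonZero;
  positive; nonNegative; ≢-nonZero; >-nonZero)
open import Data.Rational.Properties
open import Data.Fin.Properties using (toℕ-inject₁; toℕ-fromℕ; toℕ<n; opposite-prop)
open import Data.List.Relation.Unary.Unique.DecPropositional.Properties using (deduplicate-!)
open import Data.Nat.ListAction.Properties using (sum-++)
open import Relation.Nullary.Decidable using (dec⇒maybe)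
open import Algebra.Bundles using (CommutativeRing)
open import Algebra.Properties.Semiring.Sum (CommutativeRing.semiring +-*-commutativeRing)
  using (sum; sum-cong-≗; sum-init-last; ∑-distrib-+; ∑-comm; *-distribˡ-sum; sum-replicate-zero)
open import Algebra.Properties.CommutativeMonoid.Sum *-1-commutativeMonoid
  using () renaming (sum to prod; sum-init-last to prod-init-last; sum-cong-≗ to prod-cong; ∑-distrib-+ to prod-distrib-*)
open import Tactic.RingSolver using (solve-∀)
open import Tactic.RingSolver.Core.AlmostCommutativeRing using (AlmostCommutativeRing; fromCommutativeRing)
open import Data.Nat.Tactic.RingSolver using () renaming (ring to ℕ-ring)
open import Data.Integer.Tactic.RingSolver using () renaming (ring to ℤ-ring)
import Algebra.Properties.AbelianGroup
import Data.Nat.Properties as ℕ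
import Data.Integer.Properties as ℤ
import Data.Rational.Unnormalised as ℚᵘ
import Data.Rational.Unnormalised.Properties as ℚᵘ
module ℤ-Group = Algebra.Properties.AbelianGroup ℤ.+-0-abelianGroup
open ≡-Reasoning

-- Determinants

ring : AlmostCommutativeRing 0ℓ 0ℓ
ring = fromCommutativeRing +-*-commutativeRing (λ x → dec⇒maybe (0ℚ ≟ x))

sgn : ℕ → ℚ
sgn zero          = 1ℚ
sgn (suc zero)    = - 1ℚ
sgn (suc (suc k)) = sgn k

-- For the sign function local to `det`, which satisfies the three equations by computation.
sgn-unique : (s : ℕ → ℚ) → s 0 ≡ 1ℚ → s 1 ≡ - 1ℚ → (∀ k → s (suc (suc k)) ≡ s k) → ∀ k → s k ≡ sgn k
sgn-unique s s0 s1 s2 zero = s0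
sgn-unique s s0 s1 s2 (suc zero) = s1
sgn-unique s s0 s1 s2 (suc (suc k)) = trans (s2 k) (sgn-unique s s0 s1 s2 k)

sgn-suc : ∀ k → sgn (suc k) ≡ - sgn k
sgn-suc zero          = refl
sgn-suc (suc zero)    = refl
sgn-suc (suc (suc k)) = sgn-suc k

sgn-square : ∀ k → sgn k * sgn k ≡ 1ℚ
sgn-square zero          = refl
sgn-square (suc zero)    = refl
sgn-square (suc (suc k)) = sgn-square k

-- The sign (-1)^(n(n-1)/2) of the permutation that reverses n elements.
sgnReverse : ℕ → ℚ
sgnReverse zero    = 1ℚ
sgnReverse (suc n) = sgn n * sgnReverse n

Matrix : ℕ → Set
Matrix n = Fin n → Fin n → ℚ

minor : ∀ {n} → Matrix (suc n) → Fin (suc n) → Fin (suc n) → Matrix n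
minor M i k a b = M (punchIn i a) (punchIn k b)

laplace : ∀ {n} → Matrix (suc n) → Fin (suc n) → ℚ
laplace {n} M k = sgn (toℕ k) * M zero k * det n (minor M zero k)

-- The position `i` that carries the sign is separate from the column `k`, so that `toℕ (ι zero)`
-- can be abstracted to a variable when the sign function is solved for.
GoSum : ∀ n (M : Matrix (suc n)) {m} → (Fin m → Fin (suc n)) → ℚ → Set
GoSum n M ι c =
  (T : ℕ → Fin (suc n) → ℚ) → (∀ i k → T i k ≡ sgn i * M zero k * det n (minor M zero k)) →
  c ≡ sum (λ k → T (toℕ (ι k)) (ι k))

GoFrom2 : ∀ m → Matrix (suc (suc m)) → ℚ → Set₁
GoFrom2 m M c =
  (G : ∀ n (M : Matrix (suc n)) {m} → (Fin m → Fin (suc n)) → ℚ → Set) →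
  (∀ {n M m} {ι : Fin m → Fin (suc n)} {c} → GoSum n M ι c → G n M ι c) →
  G (suc m) M (λ (k : Fin m) → suc (suc k)) c

-- The loop and the sign function inside det are local and cannot be named.  Unfolding det
-- at size m + 2 leaves the loop applied to the matrix size m + 1 and the counter m, and
-- abstracting over the term m + 1 makes these two arguments independent variables; the
-- loop is then the solution of the underscores below.  Multiplication is abstracted as well,
-- since a product with an unsolved factor blocks unification.
mutual
  det-suc : ∀ {n} (M : Matrix (suc n)) → det (suc n) M ≡ sum (laplace M)
  det-suc {zero}  M = refl
  det-suc {suc m} M = cong (λ z → laplace M zero + (laplace M (suc zero) + z))
    (go-from-2 m M GoSum (λ e → e) (λ i k → sgn i * M zero k * det (suc m) (minor M zero k)) (λ _ _ → refl))

  go-from-2 : ∀ m M → GoFrom2 m M _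
  go-from-2 m M G H with suc m | M | (λ (k : Fin m) → Fin.suc (Fin.suc k))
  ... | n | N | ι = H (go-sum n N m ι)

  go-sum : ∀ n M m (ι : Fin m → Fin (suc n)) → GoSum n M ι _
  go-sum n M zero    ι T T≡ = refl
  go-sum n M (suc m) ι T T≡ with _*_ | toℕ (ι zero) | T≡ | go-sum n M m (λ k → ι (suc k)) T T≡
  ... | _⋆_ | i | t≡ | ih =
    cong₂ _+_ (trans (cong (λ z → (z ⋆ M zero (ι zero)) ⋆ det n (minor M zero (ι zero))) (go-sgn n M i))
                     (sym (t≡ i (ι zero)))) ih

  go-sgn : ∀ n (M : Matrix (suc n)) j → _ ≡ sgn j
  go-sgn n M = sgn-unique _ refl refl (λ _ → refl)

det-cong : ∀ {n} {M N : Matrix n} → (∀ i j → M i j ≡ N i j) → det n M ≡ det n N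
det-cong {zero}          e = refl
det-cong {suc n} {M} {N} e = begin
  det (suc n) M   ≡⟨ det-suc M ⟩
  sum (laplace M) ≡⟨ sum-cong-≗ (λ k → cong₂ (λ x y → sgn (toℕ k) * x * y) (e zero k)
                                  (det-cong (λ i j → e (suc i) (punchIn k j)))) ⟩
  sum (laplace N) ≡⟨ det-suc N ⟨
  det (suc n) N   ∎

sum-*-swap : ∀ {m n} (a : Fin m → ℚ) (a′ : Fin n → ℚ) (u v : Fin n → Fin m → ℚ) →
             (∀ i k → a k * u i k ≡ a′ i * v i k) →
             sum (λ k → a k * sum (λ i → u i k)) ≡ sum (λ i → a′ i * sum (v i))
sum-*-swap a a′ u v e = begin
  sum (λ k → a k * sum (λ i → u i k))   ≡⟨ sum-cong-≗ (λ k → *-distribˡ-sum (a k) (λ i → u i k)) ⟩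
  sum (λ k → sum (λ i → a k * u i k))   ≡⟨ ∑-comm (λ k i → a k * u i k) ⟩
  sum (λ i → sum (λ k → a k * u i k))   ≡⟨ sum-cong-≗ (λ i → sum-cong-≗ (e i)) ⟩
  sum (λ i → sum (λ k → a′ i * v i k))  ≡⟨ sum-cong-≗ (λ i → *-distribˡ-sum (a′ i) (v i)) ⟨
  sum (λ i → a′ i * sum (v i))          ∎

private
  swap-signs : ∀ a b x y d → (- a * x) * (b * y * d) ≡ (- b * y) * (a * x * d)
  swap-signs = solve-∀ ring

swap-sgn : ∀ i k x y d → (sgn (suc i) * x) * (sgn k * y * d) ≡ (sgn (suc k) * y) * (sgn i * x * d)
swap-sgn i k x y d rewrite sgn-suc i | sgn-suc k = swap-signs (sgn i) (sgn k) x y d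

-- The corner term is common to both expansions. Elsewhere, expanding the minors once more leads on
-- both sides to the same minors `d`, and the double sum is read in the other order.
det-col : ∀ {n} (M : Matrix (suc n)) →
          det (suc n) M ≡ sum (λ i → sgn (toℕ i) * M i zero * det n (minor M i zero))
det-col {zero}  M = refl
det-col {suc n} M = begin
  det (suc (suc n)) M
    ≡⟨ det-suc M ⟩
  laplace M zero + sum (λ k → sgn (suc (toℕ k)) * M zero (suc k) * det (suc n) (minor M zero (suc k)))
    ≡⟨ cong (laplace M zero +_) (sum-cong-≗ (λ k → cong (sgn (suc (toℕ k)) * M zero (suc k) *_)
         (det-col (minor M zero (suc k))))) ⟩
  laplace M zero + sum (λ k → sgn (suc (toℕ k)) * M zero (suc k) * sum (λ i → sgn (toℕ i) * M (suc i) zero * d i k))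
    ≡⟨ cong (laplace M zero +_) (sum-*-swap (λ k → sgn (suc (toℕ k)) * M zero (suc k)) (λ i → sgn (suc (toℕ i)) * M (suc i) zero)
         (λ i k → sgn (toℕ i) * M (suc i) zero * d i k) (λ i k → sgn (toℕ k) * M zero (suc k) * d i k) (λ i k →
         swap-sgn (toℕ k) (toℕ i) (M zero (suc k)) (M (suc i) zero) (d i k))) ⟩
  laplace M zero + sum (λ i → sgn (suc (toℕ i)) * M (suc i) zero * sum (λ k → sgn (toℕ k) * M zero (suc k) * d i k))
    ≡⟨ cong (laplace M zero +_) (sum-cong-≗ (λ i → cong (sgn (suc (toℕ i)) * M (suc i) zero *_)
         (det-suc (minor M (suc i) zero)))) ⟨
  laplace M zero + sum (λ i → sgn (suc (toℕ i)) * M (suc i) zero * det (suc n) (minor M (suc i) zero)) ∎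
  where
  d : Matrix (suc n)
  d i k = det n (λ a b → M (suc (punchIn i a)) (suc (punchIn k b)))

det-transpose : ∀ {n} (M : Matrix n) → det n (λ i j → M j i) ≡ det n M
det-transpose {zero}  M = refl
det-transpose {suc n} M = begin
  det (suc n) (λ i j → M j i)
    ≡⟨ det-suc (λ i j → M j i) ⟩
  sum (λ k → sgn (toℕ k) * M k zero * det n (λ i j → M (punchIn k j) (suc i)))
    ≡⟨ sum-cong-≗ (λ k → cong (sgn (toℕ k) * M k zero *_) (det-transpose (minor M k zero))) ⟩
  sum (λ k → sgn (toℕ k) * M k zero * det n (minor M k zero))
    ≡⟨ det-col M ⟨
  det (suc n) M ∎

punchIn-fromℕ : ∀ {n} (a : Fin n) → punchIn (fromℕ n) a ≡ inject₁ a
punchIn-fromℕ zero    = refl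
punchIn-fromℕ (suc a) = cong suc (punchIn-fromℕ a)

punchIn-inject₁-fromℕ : ∀ {n} (i : Fin (suc n)) → punchIn (inject₁ i) (fromℕ n) ≡ fromℕ (suc n)
punchIn-inject₁-fromℕ zero            = refl
punchIn-inject₁-fromℕ {suc n} (suc i) = cong suc (punchIn-inject₁-fromℕ i)

punchIn-inject₁ : ∀ {n} (i : Fin (suc n)) (a : Fin n) → punchIn (inject₁ i) (inject₁ a) ≡ inject₁ (punchIn i a)
punchIn-inject₁ zero    a       = refl
punchIn-inject₁ (suc i) zero    = refl
punchIn-inject₁ (suc i) (suc a) = cong suc (punchIn-inject₁ i a)

lastMinor : ∀ {n} → Matrix (suc n) → Fin (suc n) → Matrix n
lastMinor M k a b = M (inject₁ a) (punchIn k b)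

private
  swap-last : ∀ s i k x y d → (i * x) * (s * (k * y) * d) ≡ (- s * (- k * y)) * (i * x * d)
  swap-last = solve-∀ ring

  last-term : ∀ s x d → s * x * d ≡ s * (1ℚ * x) * d
  last-term = solve-∀ ring

swap-last-sgn : ∀ s i k x y d →
  (sgn i * x) * (sgn s * (sgn k * y) * d) ≡ (sgn (suc s) * (sgn (suc k) * y)) * (sgn i * x * d)
swap-last-sgn s i k x y d rewrite sgn-suc s | sgn-suc k = swap-last (sgn s) (sgn i) (sgn k) x y d

-- In the expansion along the first column every minor but the last still contains the last row, to
-- which the induction applies; the last one supplies the term of column `zero`.
det-last-row : ∀ {n} (M : Matrix (suc n)) → det (suc n) M ≡
               sum (λ k → sgn n * (sgn (toℕ k) * M (fromℕ n) k) * det n (lastMinor M k))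
det-last-row {zero}  M = last-term′ (M zero zero)
  where
  last-term′ : ∀ x → 1ℚ * x * 1ℚ + 0ℚ ≡ 1ℚ * (1ℚ * x) * 1ℚ + 0ℚ
  last-term′ = solve-∀ ring
det-last-row {suc n} M = begin
  det (suc (suc n)) M
    ≡⟨ det-col M ⟩
  sum t
    ≡⟨ sum-init-last t ⟩
  sum (λ i → t (inject₁ i)) + t (fromℕ (suc n))
    ≡⟨ cong₂ _+_ (sum-cong-≗ inner) outer ⟩
  sum (λ i → sgn (toℕ i) * M (inject₁ i) zero *
    sum (λ k → sgn n * (sgn (toℕ k) * M (fromℕ (suc n)) (suc k)) * d i k)) + r zero
    ≡⟨ cong (_+ r zero) (sum-*-swap (λ i → sgn (toℕ i) * M (inject₁ i) zero)
         (λ k → sgn (suc n) * (sgn (suc (toℕ k)) * M (fromℕ (suc n)) (suc k)))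
         (λ k i → sgn n * (sgn (toℕ k) * M (fromℕ (suc n)) (suc k)) * d i k)
         (λ k i → sgn (toℕ i) * M (inject₁ i) zero * d i k) (λ k i →
         swap-last-sgn n (toℕ i) (toℕ k) (M (inject₁ i) zero) (M (fromℕ (suc n)) (suc k)) (d i k))) ⟩
  sum (λ k → sgn (suc n) * (sgn (suc (toℕ k)) * M (fromℕ (suc n)) (suc k)) *
    sum (λ i → sgn (toℕ i) * M (inject₁ i) zero * d i k)) + r zero
    ≡⟨ cong (_+ r zero) (sum-cong-≗ (λ k →
         cong (sgn (suc n) * (sgn (suc (toℕ k)) * M (fromℕ (suc n)) (suc k)) *_) (det-col (lastMinor M (suc k))))) ⟨
  sum (λ k → r (suc k)) + r zero
    ≡⟨ +-comm (sum (λ k → r (suc k))) (r zero) ⟩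
  sum r ∎
  where
  t r : Fin (suc (suc n)) → ℚ
  t i = sgn (toℕ i) * M i zero * det (suc n) (minor M i zero)
  r k = sgn (suc n) * (sgn (toℕ k) * M (fromℕ (suc n)) k) * det (suc n) (lastMinor M k)

  d : Matrix (suc n)
  d i k = det n (λ a b → M (inject₁ (punchIn i a)) (suc (punchIn k b)))

  inner : ∀ i → t (inject₁ i) ≡ sgn (toℕ i) * M (inject₁ i) zero *
          sum (λ k → sgn n * (sgn (toℕ k) * M (fromℕ (suc n)) (suc k)) * d i k)
  inner i = cong₂ (λ x y → sgn x * M (inject₁ i) zero * y) (toℕ-inject₁ i)
    (trans (det-last-row (minor M (inject₁ i) zero)) (sum-cong-≗ (λ k →
      cong₂ (λ x y → sgn n * (sgn (toℕ k) * x) * y)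
        (cong (λ x → M x (suc k)) (punchIn-inject₁-fromℕ i))
        (det-cong (λ a b → cong (λ x → M x (suc (punchIn k b))) (punchIn-inject₁ i a))))))

  outer : t (fromℕ (suc n)) ≡ r zero
  outer = trans
    (cong₂ (λ x y → sgn x * M (fromℕ (suc n)) zero * y) (toℕ-fromℕ (suc n))
      (det-cong (λ a b → cong (λ x → M x (suc b)) (punchIn-fromℕ a))))
    (last-term (sgn (suc n)) (M (fromℕ (suc n)) zero) (det (suc n) (lastMinor M zero)))

opposite-inject₁ : ∀ {n} (i : Fin n) → opposite (inject₁ i) ≡ suc (opposite i)
opposite-inject₁ zero    = refl
opposite-inject₁ (suc i) = cong inject₁ (opposite-inject₁ i)

opposite-fromℕ : ∀ n → opposite (fromℕ n) ≡ zero
opposite-fromℕ zero    = refl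
opposite-fromℕ (suc n) = cong inject₁ (opposite-fromℕ n)

-- Expanding the reversed matrix along its last row is expanding `M` along its first, up to a factor
-- `sgn n` that `sgnReverse` collects.
det-reverse : ∀ {n} (M : Matrix n) → det n (λ i j → M (opposite i) j) ≡ sgnReverse n * det n M
det-reverse {zero}  M = refl
det-reverse {suc n} M = begin
  det (suc n) (λ i j → M (opposite i) j)
    ≡⟨ det-last-row (λ i j → M (opposite i) j) ⟩
  sum (λ k → sgn n * (sgn (toℕ k) * M (opposite (fromℕ n)) k) *
             det n (λ a b → M (opposite (inject₁ a)) (punchIn k b)))
    ≡⟨ sum-cong-≗ (λ k → trans
         (cong₂ (λ x y → sgn n * (sgn (toℕ k) * x) * y)
           (cong (λ x → M x k) (opposite-fromℕ n))
           (trans (det-cong (λ a b → cong (λ x → M x (punchIn k b)) (opposite-inject₁ a)))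
                  (det-reverse (minor M zero k))))
         (rearrange (sgn n) (sgnReverse n) (sgn (toℕ k) * M zero k) (det n (minor M zero k)))) ⟩
  sum (λ k → sgnReverse (suc n) * laplace M k)
    ≡⟨ *-distribˡ-sum (sgnReverse (suc n)) (laplace M) ⟨
  sgnReverse (suc n) * sum (laplace M)
    ≡⟨ cong (sgnReverse (suc n) *_) (det-suc M) ⟨
  sgnReverse (suc n) * det (suc n) M ∎
  where
  rearrange : ∀ a b x d → a * x * (b * d) ≡ (a * b) * (x * d)
  rearrange = solve-∀ ring

private
  cancel : ∀ x d → 1ℚ * x * d + (- 1ℚ * x * d + 0ℚ) ≡ 0ℚ
  cancel = solve-∀ ring

  zero-term : ∀ s x → s * x * 0ℚ ≡ 0ℚ
  zero-term = solve-∀ ring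

sum-zero : ∀ {n} {t : Fin n → ℚ} → (∀ i → t i ≡ 0ℚ) → sum t ≡ 0ℚ
sum-zero {n} e = trans (sum-cong-≗ e) (sum-replicate-zero n)

-- In the expansion along the first column the first two terms cancel, and all other minors keep the
-- two equal rows.
det-equal-rows : ∀ {n} (M : Matrix (suc (suc n))) → (∀ j → M zero j ≡ M (suc zero) j) →
                 det (suc (suc n)) M ≡ 0ℚ
det-equal-rows {n} M e = begin
  det (suc (suc n)) M
    ≡⟨ det-col M ⟩
  t zero + (t (suc zero) + sum (λ i → t (suc (suc i))))
    ≡⟨ cong₂ _+_ {x = t zero} refl (cong₂ _+_ second (sum-zero (λ i →
         trans (cong (sgn (toℕ i) * M (suc (suc i)) zero *_) (rest i)) (zero-term (sgn (toℕ i)) (M (suc (suc i)) zero))))) ⟩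
  t zero + (- 1ℚ * M zero zero * det (suc n) (minor M zero zero) + 0ℚ)
    ≡⟨ cancel (M zero zero) (det (suc n) (minor M zero zero)) ⟩
  0ℚ ∎
  where
  t : Fin (suc (suc n)) → ℚ
  t i = sgn (toℕ i) * M i zero * det (suc n) (minor M i zero)

  second : t (suc zero) ≡ - 1ℚ * M zero zero * det (suc n) (minor M zero zero)
  second = cong₂ (λ x y → - 1ℚ * x * y) (sym (e zero))
    (det-cong {M = minor M (suc zero) zero} {N = minor M zero zero} (λ { zero b → e (suc b) ; (suc a) b → refl }))

  -- An element of `Fin n` forces `n` to be a successor, so the minor again has two rows at its top;
  -- `aux` generalises `n` to make this case split possible.
  rest : ∀ i → det (suc n) (minor M (suc (suc i)) zero) ≡ 0ℚ
  rest i = aux i M e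
    where
    aux : ∀ {n} (i : Fin n) (M : Matrix (suc (suc n))) → (∀ j → M zero j ≡ M (suc zero) j) →
          det (suc n) (minor M (suc (suc i)) zero) ≡ 0ℚ
    aux {suc n} i M e = det-equal-rows (minor M (suc (suc i)) zero) (λ j → e (suc j))

differences : ∀ {n m} → ℚ → (Fin (suc n) → Fin m → ℚ) → Fin (suc n) → Fin m → ℚ
differences {zero}  c r i       j = r i j
differences {suc n} c r zero    j = r zero j - c * r (suc zero) j
differences {suc n} c r (suc i) j = differences c (λ a → r (suc a)) i j

differences-inject₁ : ∀ {n m} c (r : Fin (suc n) → Fin m → ℚ) i j →
  differences c r (inject₁ i) j ≡ r (inject₁ i) j - c * r (suc i) j
differences-inject₁ {suc n} c r zero    j = refl
differences-inject₁ {suc n} c r (suc i) j = differences-inject₁ c (λ a → r (suc a)) i j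

differences-fromℕ : ∀ {n m} c (r : Fin (suc n) → Fin m → ℚ) j → differences c r (fromℕ n) j ≡ r (fromℕ n) j
differences-fromℕ {zero}  c r j = refl
differences-fromℕ {suc n} c r j = differences-fromℕ c (λ a → r (suc a)) j

differences-∘ : ∀ {n m l} c (r : Fin (suc n) → Fin m → ℚ) (f : Fin l → Fin m) i j →
  differences c r i (f j) ≡ differences c (λ a b → r a (f b)) i j
differences-∘ {zero}  c r f i       j = refl
differences-∘ {suc n} c r f zero    j = refl
differences-∘ {suc n} c r f (suc i) j = differences-∘ c (λ a → r (suc a)) f i j

-- The induction restores the rows below the first. Linearity in the first row then leaves a
-- correction whose first two rows agree.
det-differences : ∀ {n} c (r : Matrix (suc n)) → det (suc n) (differences c r) ≡ det (suc n) r
det-differences {zero}  c r = refl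
det-differences {suc n} c r = begin
  det (suc (suc n)) (differences c r)
    ≡⟨ det-suc (differences c r) ⟩
  sum (λ k → sgn (toℕ k) * (r zero k - c * r (suc zero) k) *
             det (suc n) (λ i j → differences c (λ a → r (suc a)) i (punchIn k j)))
    ≡⟨ sum-cong-≗ (λ k → trans
         (cong (sgn (toℕ k) * (r zero k - c * r (suc zero) k) *_)
           (trans (det-cong (differences-∘ c (λ a → r (suc a)) (punchIn k)))
                  (det-differences c (minor r zero k))))
         (split (sgn (toℕ k)) (r zero k) (r (suc zero) k) (det (suc n) (minor r zero k)))) ⟩
  sum (λ k → laplace r k + - c * laplace doubled k)
    ≡⟨ ∑-distrib-+ (laplace r) (λ k → - c * laplace doubled k) ⟩
  sum (laplace r) + sum (λ k → - c * laplace doubled k)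
    ≡⟨ cong₂ _+_ (sym (det-suc r)) (trans (sym (*-distribˡ-sum (- c) (laplace doubled)))
         (cong (- c *_) (trans (sym (det-suc doubled)) (det-equal-rows doubled (λ j → refl))))) ⟩
  det (suc (suc n)) r + - c * 0ℚ
    ≡⟨ absorb (det (suc (suc n)) r) ⟩
  det (suc (suc n)) r ∎
  where
  doubled : Matrix (suc (suc n))
  doubled zero    = r (suc zero)
  doubled (suc i) = r (suc i)

  split′ : ∀ c s x y d → s * (x - c * y) * d ≡ s * x * d + - c * (s * y * d)
  split′ = solve-∀ ring
  split = split′ c

  absorb′ : ∀ c x → x + - c * 0ℚ ≡ x
  absorb′ = solve-∀ ring
  absorb = absorb′ c

det-unit-last-row : ∀ {n} (M : Matrix (suc n)) → (∀ j → M (fromℕ n) (inject₁ j) ≡ 0ℚ) →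
  M (fromℕ n) (fromℕ n) ≡ 1ℚ → det (suc n) M ≡ det n (λ a b → M (inject₁ a) (inject₁ b))
det-unit-last-row {n} M e0 e1 = begin
  det (suc n) M
    ≡⟨ det-last-row M ⟩
  sum r
    ≡⟨ sum-init-last r ⟩
  sum (λ k → r (inject₁ k)) + r (fromℕ n)
    ≡⟨ cong₂ _+_ (sum-zero (λ k → trans
         (cong (λ x → sgn n * (sgn (toℕ (inject₁ k)) * x) * det n (lastMinor M (inject₁ k))) (e0 k))
         (vanish (sgn n) (sgn (toℕ (inject₁ k))) (det n (lastMinor M (inject₁ k)))))) refl ⟩
  0ℚ + r (fromℕ n)
    ≡⟨ cong (0ℚ +_) (cong₂ (λ x y → sgn n * x * y)
         (cong₂ (λ x y → sgn x * y) (toℕ-fromℕ n) e1)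
         (det-cong (λ a b → cong (M (inject₁ a)) (punchIn-fromℕ b)))) ⟩
  0ℚ + sgn n * (sgn n * 1ℚ) * det n (λ a b → M (inject₁ a) (inject₁ b))
    ≡⟨ assoc (sgn n) (det n (λ a b → M (inject₁ a) (inject₁ b))) ⟩
  sgn n * sgn n * det n (λ a b → M (inject₁ a) (inject₁ b))
    ≡⟨ cong (_* det n (λ a b → M (inject₁ a) (inject₁ b))) (sgn-square n) ⟩
  1ℚ * det n (λ a b → M (inject₁ a) (inject₁ b))
    ≡⟨ *-identityˡ _ ⟩
  det n (λ a b → M (inject₁ a) (inject₁ b)) ∎
  where
  r : Fin (suc n) → ℚ
  r k = sgn n * (sgn (toℕ k) * M (fromℕ n) k) * det n (lastMinor M k)

  vanish : ∀ s t d → s * (t * 0ℚ) * d ≡ 0ℚ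
  vanish = solve-∀ ring

  assoc : ∀ s d → 0ℚ + s * (s * 1ℚ) * d ≡ s * s * d
  assoc = solve-∀ ring

-- When every entry of the last column is `c` times the one below it, subtracting `c` times the next
-- row clears that column except for the final 1. Vandermonde's formula takes for `c` the last
-- variable; the sum over interlacing sequences takes `c` = 1 and a column of ones.
det-reduce : ∀ {n} c (r : Matrix (suc n)) →
  (∀ i → r (inject₁ i) (fromℕ n) ≡ c * r (suc i) (fromℕ n)) → r (fromℕ n) (fromℕ n) ≡ 1ℚ →
  det (suc n) r ≡ det n (λ i j → r (inject₁ i) (inject₁ j) - c * r (suc i) (inject₁ j))
det-reduce {n} c r e0 e1 = begin
  det (suc n) r
    ≡⟨ det-differences c r ⟨
  det (suc n) (differences c r)
    ≡⟨ det-transpose (differences c r) ⟨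
  det (suc n) (λ i j → differences c r j i)
    ≡⟨ det-unit-last-row (λ i j → differences c r j i)
         (λ j → trans (differences-inject₁ c r j (fromℕ n))
                  (trans (cong (_- c * r (suc j) (fromℕ n)) (e0 j)) (+-inverseʳ (c * r (suc j) (fromℕ n)))))
         (trans (differences-fromℕ c r (fromℕ n)) e1) ⟩
  det n (λ i j → differences c r (inject₁ j) (inject₁ i))
    ≡⟨ det-transpose (λ i j → differences c r (inject₁ i) (inject₁ j)) ⟩
  det n (λ i j → differences c r (inject₁ i) (inject₁ j))
    ≡⟨ det-cong (λ i j → differences-inject₁ c r i (inject₁ j)) ⟩
  det n (λ i j → r (inject₁ i) (inject₁ j) - c * r (suc i) (inject₁ j)) ∎

det-scale-rows : ∀ {n} (c : Fin n → ℚ) (M : Matrix n) → det n (λ i j → c i * M i j) ≡ prod c * det n M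
det-scale-rows {zero}  c M = refl
det-scale-rows {suc n} c M = begin
  det (suc n) (λ i j → c i * M i j)
    ≡⟨ det-suc (λ i j → c i * M i j) ⟩
  sum (λ k → sgn (toℕ k) * (c zero * M zero k) * det n (λ i j → c (suc i) * minor M zero k i j))
    ≡⟨ sum-cong-≗ (λ k → trans
         (cong (sgn (toℕ k) * (c zero * M zero k) *_) (det-scale-rows (λ i → c (suc i)) (minor M zero k)))
         (rearrange (c zero) (prod (λ i → c (suc i))) (sgn (toℕ k)) (M zero k) (det n (minor M zero k)))) ⟩
  sum (λ k → prod c * laplace M k)
    ≡⟨ *-distribˡ-sum (prod c) (laplace M) ⟨
  prod c * sum (laplace M)
    ≡⟨ cong (prod c *_) (det-suc M) ⟨
  prod c * det (suc n) M ∎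
  where
  rearrange : ∀ a p s x d → s * (a * x) * (p * d) ≡ a * p * (s * x * d)
  rearrange = solve-∀ ring

det-scale-cols : ∀ {n} (c : Fin n → ℚ) (M : Matrix n) → det n (λ i j → M i j * c j) ≡ prod c * det n M
det-scale-cols {n} c M = begin
  det n (λ i j → M i j * c j)  ≡⟨ det-transpose (λ i j → M i j * c j) ⟨
  det n (λ i j → M j i * c i)  ≡⟨ det-cong (λ i j → *-comm (M j i) (c i)) ⟩
  det n (λ i j → c i * M j i)  ≡⟨ det-scale-rows c (λ i j → M j i) ⟩
  prod c * det n (λ i j → M j i) ≡⟨ cong (prod c *_) (det-transpose M) ⟩
  prod c * det n M             ∎

-- The Vandermonde determinant and sums over interlacing sequences

^-+ : ∀ q a b → q ^ℚ (a ℕ.+ b) ≡ q ^ℚ a * q ^ℚ b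
^-+ q zero    b = sym (*-identityˡ _)
^-+ q (suc a) b = trans (cong (q *_) (^-+ q a b)) (sym (*-assoc q (q ^ℚ a) (q ^ℚ b)))

^-* : ∀ q a b → (q ^ℚ a) ^ℚ b ≡ q ^ℚ (b ℕ.* a)
^-* q a zero    = refl
^-* q a (suc b) = trans (cong (q ^ℚ a *_) (^-* q a b)) (sym (^-+ q a (b ℕ.* a)))

-- Exchanges variables and exponents in a determinant of powers of `q`. This turns the numerator of
-- s_μ(q^δ) into a Vandermonde determinant, and the sum over a row entry into a geometric series.
^-swap : ∀ q a b → (q ^ℚ a) ^ℚ b ≡ (q ^ℚ b) ^ℚ a
^-swap q a b = trans (^-* q a b) (trans (cong (q ^ℚ_) (ℕ.*-comm b a)) (sym (^-* q b a)))

prodR-cong : ∀ n {f g : ℕ → ℚ} → (∀ i → 1 ℕ.≤ i → i ℕ.≤ n → f i ≡ g i) → prodR n f ≡ prodR n g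
prodR-cong zero    e = refl
prodR-cong (suc n) e = cong₂ _*_ (prodR-cong n (λ i 1≤i i≤n → e i 1≤i (ℕ.m≤n⇒m≤1+n i≤n)))
                                 (e (suc n) (ℕ.s≤s ℕ.z≤n) ℕ.≤-refl)

prodR-prod : ∀ n (f : ℕ → ℚ) → prodR n f ≡ prod {n} (λ j → f (suc (toℕ j)))
prodR-prod zero    f = refl
prodR-prod (suc n) f = begin
  prodR n f * f (suc n)
    ≡⟨ cong₂ _*_ (prodR-prod n f) (cong (λ i → f (suc i)) (sym (toℕ-fromℕ n))) ⟩
  prod {n} (λ j → f (suc (toℕ j))) * f (suc (toℕ (fromℕ n)))
    ≡⟨ cong (_* f (suc (toℕ (fromℕ n)))) (prod-cong {n} (λ j → cong (λ i → f (suc i)) (toℕ-inject₁ j))) ⟨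
  prod {n} (λ j → f (suc (toℕ (inject₁ j)))) * f (suc (toℕ (fromℕ n)))
    ≡⟨ prod-init-last {n} (λ j → f (suc (toℕ j))) ⟨
  prod {suc n} (λ j → f (suc (toℕ j))) ∎

prodR-flip-signs : ∀ n (x : ℕ → ℚ) c → prodR n (λ i → x i - c) ≡ sgn n * prodR n (λ i → c - x i)
prodR-flip-signs zero    x c = refl
prodR-flip-signs (suc n) x c rewrite sgn-suc n =
  trans (cong (_* (x (suc n) - c)) (prodR-flip-signs n x c)) (flip (sgn n) _ (x (suc n)) c)
  where
  flip : ∀ s p y c → s * p * (y - c) ≡ - s * (p * (c - y))
  flip = solve-∀ ring

-- After the last column is cleared, column j has the common factor x_j - x_(n+1). The factors of
-- `vandBar` are the opposite differences, hence the sign.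
vandermonde : ∀ n (x : ℕ → ℚ) →
  det n (λ i j → x (suc (toℕ j)) ^ℚ (n ∸ suc (toℕ i))) ≡ sgnReverse n * vandBar n x
vandermonde zero    x = refl
vandermonde (suc n) x = begin
  det (suc n) r
    ≡⟨ det-reduce c r
         (λ i → trans (cong₂ _^ℚ_ x-last (exponent i)) (cong (λ y → c * y ^ℚ e i) (sym x-last)))
         (cong (x (suc (toℕ (fromℕ n))) ^ℚ_) (trans (cong (n ∸_) (toℕ-fromℕ n)) (ℕ.n∸n≡0 n))) ⟩
  det n (λ i j → r (inject₁ i) (inject₁ j) - c * r (suc i) (inject₁ j))
    ≡⟨ det-cong (λ i j → trans
         (cong₂ _-_ (cong₂ (λ a b → x (suc a) ^ℚ b) (toℕ-inject₁ j) (exponent i))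
                    (cong (λ a → c * x (suc a) ^ℚ e i) (toℕ-inject₁ j)))
         (factor (x (suc (toℕ j))) c (x (suc (toℕ j)) ^ℚ e i))) ⟩
  det n (λ i j → x (suc (toℕ j)) ^ℚ e i * (x (suc (toℕ j)) - c))
    ≡⟨ det-scale-cols (λ j → x (suc (toℕ j)) - c) (λ i j → x (suc (toℕ j)) ^ℚ e i) ⟩
  prod {n} (λ j → x (suc (toℕ j)) - c) * det n (λ i j → x (suc (toℕ j)) ^ℚ e i)
    ≡⟨ cong₂ _*_ (trans (sym (prodR-prod n (λ j → x j - c))) (prodR-flip-signs n x c)) (vandermonde n x) ⟩
  sgn n * prodR n (λ i → c - x i) * (sgnReverse n * vandBar n x)
    ≡⟨ rearrange (sgn n) (prodR n (λ i → c - x i)) (sgnReverse n) (vandBar n x) ⟩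
  sgnReverse (suc n) * vandBar (suc n) x ∎
  where
  c = x (suc n)

  r : Matrix (suc n)
  r i j = x (suc (toℕ j)) ^ℚ (suc n ∸ suc (toℕ i))

  e : Fin n → ℕ
  e i = n ∸ suc (toℕ i)

  x-last : x (suc (toℕ (fromℕ n))) ≡ c
  x-last = cong (λ i → x (suc i)) (toℕ-fromℕ n)

  exponent : ∀ (i : Fin n) → suc n ∸ suc (toℕ (inject₁ i)) ≡ suc (e i)
  exponent i = trans (cong (n ∸_) (toℕ-inject₁ i)) (n∸i≡suc (toℕ<n i))

  factor : ∀ y c p → y * p - c * p ≡ p * (y - c)
  factor = solve-∀ ring

  rearrange : ∀ s p t v → s * p * (t * v) ≡ (s * t) * (v * p)
  rearrange = solve-∀ ring

sumOver : ∀ {A : Set} → (A → ℚ) → List A → ℚ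
sumOver f xs = sumQ (map f xs)

module _ {A : Set} where

  sumOver-cong : ∀ {f g : A → ℚ} xs → (∀ x → f x ≡ g x) → sumOver f xs ≡ sumOver g xs
  sumOver-cong []       e = refl
  sumOver-cong (x ∷ xs) e = cong₂ _+_ (e x) (sumOver-cong xs e)

  sumOver-++ : ∀ (f : A → ℚ) xs ys → sumOver f (xs ++ ys) ≡ sumOver f xs + sumOver f ys
  sumOver-++ f []       ys = sym (+-identityˡ _)
  sumOver-++ f (x ∷ xs) ys = trans (cong (f x +_) (sumOver-++ f xs ys)) (sym (+-assoc (f x) _ _))

  sumOver-*ˡ : ∀ c (f : A → ℚ) xs → sumOver (λ x → c * f x) xs ≡ c * sumOver f xs
  sumOver-*ˡ c f []       = sym (*-zeroʳ c)
  sumOver-*ˡ c f (x ∷ xs) = trans (cong (c * f x +_) (sumOver-*ˡ c f xs)) (sym (*-distribˡ-+ c (f x) _))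

  sumOver-*ʳ : ∀ c (f : A → ℚ) xs → sumOver (λ x → f x * c) xs ≡ sumOver f xs * c
  sumOver-*ʳ c f xs = trans (sumOver-cong xs (λ x → *-comm (f x) c))
                            (trans (sumOver-*ˡ c f xs) (*-comm c _))

  sumOver-sum : ∀ {n} (t : Fin n → A → ℚ) xs →
                sumOver (λ x → sum (λ k → t k x)) xs ≡ sum (λ k → sumOver (t k) xs)
  sumOver-sum {n} t []       = sym (sum-replicate-zero n)
  sumOver-sum     t (x ∷ xs) = trans (cong (sum (λ k → t k x) +_) (sumOver-sum t xs))
                                 (sym (∑-distrib-+ (λ k → t k x) (λ k → sumOver (t k) xs)))

sumOver-map : ∀ {A B : Set} (f : B → ℚ) (g : A → B) xs → sumOver f (map g xs) ≡ sumOver (λ x → f (g x)) xs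
sumOver-map f g []       = refl
sumOver-map f g (x ∷ xs) = cong (f (g x) +_) (sumOver-map f g xs)

sumOver-product : ∀ {A B C : Set} (f : C → ℚ) (_∙_ : A → B → C) xs ys →
  sumOver f (cartesianProductWith _∙_ xs ys) ≡ sumOver (λ x → sumOver (λ y → f (x ∙ y)) ys) xs
sumOver-product f _∙_ []       ys = refl
sumOver-product f _∙_ (x ∷ xs) ys = trans (sumOver-++ f (map (x ∙_) ys) _)
  (cong₂ _+_ (sumOver-map f (x ∙_) ys) (sumOver-product f _∙_ xs ys))

-- Multilinearity in the rows: `interlacing μ` is a product of intervals, and row `a` depends on the
-- a-th coordinate only. The entries `φ` are arbitrary so that the induction can pass to minors.
det-interlacing : ∀ n μ → length μ ≡ suc n → (φ : Fin n → ℕ → Fin n → ℚ) →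
  sumOver (λ ν → det n (λ a b → φ a (nthD ν (toℕ a)) b)) (interlacing μ) ≡
  det n (λ a b → sumOver (λ x → φ a x b) (interval (nthD μ (toℕ a)) (nthD μ (suc (toℕ a)))))
det-interlacing zero    (x ∷ [])    |μ| φ = refl
det-interlacing (suc n) (x ∷ y ∷ μ) |μ| φ = begin
  sumOver F (interlacing (x ∷ y ∷ μ))
    ≡⟨ sumOver-product F _∷_ (interval x y) (interlacing (y ∷ μ)) ⟩
  sumOver (λ z → sumOver (λ ν → F (z ∷ ν)) (interlacing (y ∷ μ))) (interval x y)
    ≡⟨ sumOver-cong (interval x y) (λ z → begin
         sumOver (λ ν → F (z ∷ ν)) (interlacing (y ∷ μ))
           ≡⟨ sumOver-cong (interlacing (y ∷ μ)) (λ ν → det-suc (λ a b → φ a (nthD (z ∷ ν) (toℕ a)) b)) ⟩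
         sumOver (λ ν → sum (λ k → sgn (toℕ k) * φ zero z k * D k ν)) (interlacing (y ∷ μ))
           ≡⟨ sumOver-sum (λ k ν → sgn (toℕ k) * φ zero z k * D k ν) (interlacing (y ∷ μ)) ⟩
         sum (λ k → sumOver (λ ν → sgn (toℕ k) * φ zero z k * D k ν) (interlacing (y ∷ μ)))
           ≡⟨ sum-cong-≗ (λ k → trans
                (sumOver-*ˡ (sgn (toℕ k) * φ zero z k) (D k) (interlacing (y ∷ μ)))
                (cong (sgn (toℕ k) * φ zero z k *_)
                  (det-interlacing n (y ∷ μ) (ℕ.suc-injective |μ|) (λ a v b → φ (suc a) v (punchIn k b))))) ⟩
         sum (λ k → sgn (toℕ k) * φ zero z k * E k) ∎) ⟩
  sumOver (λ z → sum (λ k → sgn (toℕ k) * φ zero z k * E k)) (interval x y)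
    ≡⟨ sumOver-sum (λ k z → sgn (toℕ k) * φ zero z k * E k) (interval x y) ⟩
  sum (λ k → sumOver (λ z → sgn (toℕ k) * φ zero z k * E k) (interval x y))
    ≡⟨ sum-cong-≗ (λ k → trans
         (sumOver-*ʳ (E k) (λ z → sgn (toℕ k) * φ zero z k) (interval x y))
         (cong (_* E k) (sumOver-*ˡ (sgn (toℕ k)) (λ z → φ zero z k) (interval x y)))) ⟩
  sum (laplace R)
    ≡⟨ det-suc R ⟨
  det (suc n) R ∎
  where
  F : List ℕ → ℚ
  F ν = det (suc n) (λ a b → φ a (nthD ν (toℕ a)) b)

  D : Fin (suc n) → List ℕ → ℚ
  D k ν = det n (λ a b → φ (suc a) (nthD ν (toℕ a)) (punchIn k b))

  R : Matrix (suc n)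
  R a b = sumOver (λ v → φ a v b) (interval (nthD (x ∷ y ∷ μ) (toℕ a)) (nthD (y ∷ μ) (toℕ a)))

  E : Fin (suc n) → ℚ
  E k = det n (minor R zero k)

-- Multiplied out, so that `p` = 1 is no exception. The function `g` is general because `applyUpTo`
-- shifts its argument in the recursion.
geometric : ∀ p a x k (g : ℕ → ℕ) → (∀ i → g i ≡ x ℕ.+ i) →
  sumOver (λ z → p ^ℚ (z ℕ.+ a)) (applyUpTo g k) * (1ℚ - p) ≡ p ^ℚ (x ℕ.+ a) - p ^ℚ (x ℕ.+ k ℕ.+ a)
geometric p a x zero    g e = trans (*-zeroˡ (1ℚ - p))
  (sym (trans (cong (λ y → p ^ℚ (x ℕ.+ a) - p ^ℚ (y ℕ.+ a)) (ℕ.+-identityʳ x)) (+-inverseʳ (p ^ℚ (x ℕ.+ a)))))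
geometric p a x (suc k) g e = begin
  (p ^ℚ (g 0 ℕ.+ a) + sumOver f (applyUpTo (λ i → g (suc i)) k)) * (1ℚ - p)
    ≡⟨ *-distribʳ-+ (1ℚ - p) (p ^ℚ (g 0 ℕ.+ a)) _ ⟩
  p ^ℚ (g 0 ℕ.+ a) * (1ℚ - p) + sumOver f (applyUpTo (λ i → g (suc i)) k) * (1ℚ - p)
    ≡⟨ cong₂ (λ y z → p ^ℚ (y ℕ.+ a) * (1ℚ - p) + z) (trans (e 0) (ℕ.+-identityʳ x))
         (geometric p a (suc x) k (λ i → g (suc i)) (λ i → trans (e (suc i)) (ℕ.+-suc x i))) ⟩
  p ^ℚ (x ℕ.+ a) * (1ℚ - p) + (p * p ^ℚ (x ℕ.+ a) - p ^ℚ (suc x ℕ.+ k ℕ.+ a))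
    ≡⟨ telescope (p ^ℚ (x ℕ.+ a)) p (p ^ℚ (suc x ℕ.+ k ℕ.+ a)) ⟩
  p ^ℚ (x ℕ.+ a) - p ^ℚ (suc x ℕ.+ k ℕ.+ a)
    ≡⟨ cong (λ y → p ^ℚ (x ℕ.+ a) - p ^ℚ (y ℕ.+ a)) (ℕ.+-suc x k) ⟨
  p ^ℚ (x ℕ.+ a) - p ^ℚ (x ℕ.+ suc k ℕ.+ a) ∎
  where
  f : ℕ → ℚ
  f z = p ^ℚ (z ℕ.+ a)

  telescope : ∀ u p v → u * (1ℚ - p) + (p * u - v) ≡ u - v
  telescope = solve-∀ ring

-- The numerator of s_λ(q^(μ+δ)), transposed and with the variables in reverse order. As `μ`
-- ascends, the staircase δ becomes the position in the list.
alternant : ℚ → (n : ℕ) → List ℕ → (ℕ → ℕ) → ℚ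
alternant q n μ l = det n (λ a b → (q ^ℚ (nthD μ (toℕ a) ℕ.+ toℕ a)) ^ℚ l (toℕ b))

interlacing-sum : ∀ q n μ (l : ℕ → ℕ) → length μ ≡ suc n → Ascending μ → l n ≡ 0 →
  sumOver (λ ν → alternant q n ν l) (interlacing μ) * prod {n} (λ b → 1ℚ - q ^ℚ l (toℕ b)) ≡ alternant q (suc n) μ l
interlacing-sum q n μ l |μ| asc l₀ = begin
  sumOver (λ ν → alternant q n ν l) (interlacing μ) * prod {n} (λ b → 1ℚ - q ^ℚ l (toℕ b))
    ≡⟨ cong (_* prod {n} (λ b → 1ℚ - q ^ℚ l (toℕ b)))
         (det-interlacing n μ |μ| (λ a x b → (q ^ℚ (x ℕ.+ toℕ a)) ^ℚ l (toℕ b))) ⟩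
  det n M * prod {n} (λ b → 1ℚ - q ^ℚ l (toℕ b))
    ≡⟨ *-comm (det n M) _ ⟩
  prod {n} (λ b → 1ℚ - q ^ℚ l (toℕ b)) * det n M
    ≡⟨ det-scale-cols (λ b → 1ℚ - q ^ℚ l (toℕ b)) M ⟨
  det n (λ a b → M a b * (1ℚ - q ^ℚ l (toℕ b)))
    ≡⟨ det-cong entry≡ ⟩
  det n (λ a b → r (inject₁ a) (inject₁ b) - 1ℚ * r (suc a) (inject₁ b))
    ≡⟨ det-reduce 1ℚ r (λ a → trans (last-col (inject₁ a)) (sym (trans (*-identityˡ _) (last-col (suc a)))))
         (last-col (fromℕ n)) ⟨
  det (suc n) r ∎
  where
  r : Matrix (suc n)
  r a b = (q ^ℚ (nthD μ (toℕ a) ℕ.+ toℕ a)) ^ℚ l (toℕ b)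

  M : Matrix n
  M a b = sumOver (λ x → (q ^ℚ (x ℕ.+ toℕ a)) ^ℚ l (toℕ b)) (interval (nthD μ (toℕ a)) (nthD μ (suc (toℕ a))))

  last-col : ∀ a → r a (fromℕ n) ≡ 1ℚ
  last-col a = cong (_ ^ℚ_) (trans (cong l (toℕ-fromℕ n)) l₀)

  entry≡ : ∀ a b → M a b * (1ℚ - q ^ℚ l (toℕ b)) ≡ r (inject₁ a) (inject₁ b) - 1ℚ * r (suc a) (inject₁ b)
  entry≡ a b = begin
    M a b * (1ℚ - p)
      ≡⟨ cong (_* (1ℚ - p)) (sumOver-cong (interval x y) (λ z → ^-swap q (z ℕ.+ toℕ a) (l (toℕ b)))) ⟩
    sumOver (λ z → p ^ℚ (z ℕ.+ toℕ a)) (interval x y) * (1ℚ - p)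
      ≡⟨ geometric p (toℕ a) x (suc y ∸ x) (x ℕ.+_) (λ i → refl) ⟩
    p ^ℚ (x ℕ.+ toℕ a) - p ^ℚ (x ℕ.+ (suc y ∸ x) ℕ.+ toℕ a)
      -- The interval includes its upper end `y`, so the series stops before y + 1 + a, which is the
      -- exponent y + (a + 1) of the next row. This match is why the rows are shifted by the
      -- staircase.
      ≡⟨ cong (λ e → p ^ℚ (x ℕ.+ toℕ a) - p ^ℚ e)
           (trans (cong (ℕ._+ toℕ a) (ℕ.m+[n∸m]≡n x≤1+y)) (sym (ℕ.+-suc y (toℕ a)))) ⟩
    p ^ℚ (x ℕ.+ toℕ a) - p ^ℚ (y ℕ.+ suc (toℕ a))
      ≡⟨ cong₂ _-_ (^-swap q (x ℕ.+ toℕ a) (l (toℕ b))) (trans (*-identityˡ _) (^-swap q (y ℕ.+ suc (toℕ a)) (l (toℕ b)))) ⟨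
    (q ^ℚ (x ℕ.+ toℕ a)) ^ℚ l (toℕ b) - 1ℚ * (q ^ℚ (y ℕ.+ suc (toℕ a))) ^ℚ l (toℕ b)
      ≡⟨ cong₂ (λ i j → (q ^ℚ (nthD μ i ℕ.+ i)) ^ℚ l j - 1ℚ * (q ^ℚ (y ℕ.+ suc (toℕ a))) ^ℚ l j)
           (sym (toℕ-inject₁ a)) (sym (toℕ-inject₁ b)) ⟩
    r (inject₁ a) (inject₁ b) - 1ℚ * r (suc a) (inject₁ b) ∎
    where
    p = q ^ℚ l (toℕ b)
    x = nthD μ (toℕ a)
    y = nthD μ (suc (toℕ a))

    x≤1+y : x ℕ.≤ suc y
    x≤1+y = ℕ.m≤n⇒m≤1+n (asc (toℕ a) (subst (suc (toℕ a) ℕ.<_) (sym |μ|) (ℕ.s≤s (toℕ<n a))))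

-- Convergence

private
  cancel-sub : ∀ a b → b - a + a ≡ b
  cancel-sub = solve-∀ ring

≤-from-diff : ∀ {a b} → 0ℚ ≤ b - a → a ≤ b
≤-from-diff {a} {b} h = subst₂ _≤_ (+-identityˡ a) (cancel-sub a b) (+-monoˡ-≤ a h)

diff-from-≤ : ∀ {a b} → a ≤ b → 0ℚ ≤ b - a
diff-from-≤ {a} {b} h = subst (_≤ b - a) (+-inverseʳ a) (+-monoˡ-≤ (- a) h)

<-from-diff : ∀ {a b} → 0ℚ < b - a → a < b
<-from-diff {a} {b} h = subst₂ _<_ (+-identityˡ a) (cancel-sub a b) (+-monoˡ-< a h)

diff-from-< : ∀ {a b} → a < b → 0ℚ < b - a
diff-from-< {a} {b} h = subst (_< b - a) (+-inverseʳ a) (+-monoˡ-< (- a) h)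

*-pos : ∀ {a b} → 0ℚ < a → 0ℚ < b → 0ℚ < a * b
*-pos {a} {b} a>0 b>0 = positive⁻¹ (a * b) {{pos*pos⇒pos a {{positive a>0}} b {{positive b>0}}}}

*-nonneg : ∀ {a b} → 0ℚ ≤ a → 0ℚ ≤ b → 0ℚ ≤ a * b
*-nonneg {a} {b} a≥0 b≥0 =
  nonNegative⁻¹ (a * b) {{nonNeg*nonNeg⇒nonNeg a {{nonNegative a≥0}} b {{nonNegative b≥0}}}}

*-monoˡ : ∀ {a b} c → 0ℚ ≤ c → a ≤ b → c * a ≤ c * b
*-monoˡ c c≥0 a≤b = *-monoˡ-≤-nonNeg c {{nonNegative c≥0}} a≤b

*-monoʳ : ∀ {a b} c → 0ℚ ≤ c → a ≤ b → a * c ≤ b * c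
*-monoʳ c c≥0 a≤b = *-monoʳ-≤-nonNeg c {{nonNegative c≥0}} a≤b

0≤1 : 0ℚ ≤ 1ℚ
0≤1 = nonNegative⁻¹ 1ℚ

p≤∣p∣ : ∀ p → p ≤ ∣ p ∣
p≤∣p∣ p with ≤-total 0ℚ p
... | inj₁ 0≤p = ≤-reflexive (sym (0≤p⇒∣p∣≡p 0≤p))
... | inj₂ p≤0 = ≤-trans p≤0 (0≤∣p∣ p)

^-pos : ∀ {q} → 0ℚ < q → ∀ n → 0ℚ < q ^ℚ n
^-pos q>0 zero    = positive⁻¹ 1ℚ
^-pos q>0 (suc n) = *-pos q>0 (^-pos q>0 n)

^-≤1 : ∀ {q} → 0ℚ < q → q ≤ 1ℚ → ∀ n → q ^ℚ n ≤ 1ℚ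
^-≤1     q>0 q≤1 zero    = ≤-refl
^-≤1 {q} q>0 q≤1 (suc n) = ≤-trans (*-monoˡ q (<⇒≤ q>0) (^-≤1 q>0 q≤1 n)) (≤-trans (≤-reflexive (*-identityʳ q)) q≤1)

fromNat : ℕ → ℚ
fromNat zero    = 0ℚ
fromNat (suc n) = 1ℚ + fromNat n

toℚᵘ-fromNat : ∀ n → toℚᵘ (fromNat n) ℚᵘ.≃ ℚᵘ.mkℚᵘ (ℤ.+ n) 0
toℚᵘ-fromNat zero    = ℚᵘ.≃-refl
toℚᵘ-fromNat (suc n) = ℚᵘ.≃-trans (toℚᵘ-homo-+ 1ℚ (fromNat n))
  (ℚᵘ.≃-trans (ℚᵘ.+-congʳ ℚᵘ.1ℚᵘ (toℚᵘ-fromNat n))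
    (ℚᵘ.*≡* (cong (λ m → (ℤ.+ 1 ℤ.+ m) ℤ.* ℤ.+ 1) (ℤ.*-identityʳ (ℤ.+ n)))))

-- The absolute value of the numerator is large enough because the denominator is at least 1.
p≤fromNat : ∀ p → ∃ λ n → p ≤ fromNat n
p≤fromNat p@(mkℚ i d _) = ℤ.∣ i ∣ , toℚᵘ-cancel-≤
  (ℚᵘ.≤-respʳ-≃ (ℚᵘ.≃-sym (toℚᵘ-fromNat ℤ.∣ i ∣)) (ℚᵘ.*≤* (bound i)))
  where
  bound : ∀ i → i ℤ.* ℤ.+ 1 ℤ.≤ ℤ.+ ℤ.∣ i ∣ ℤ.* ℤ.+ suc d
  bound (ℤ.+ n)    = subst₂ ℤ._≤_ (ℤ.pos-* n 1) (ℤ.pos-* n (suc d)) (ℤ.+≤+ (ℕ.*-monoʳ-≤ n (ℕ.s≤s ℕ.z≤n)))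
  bound -[1+ n ] = subst (-[1+ n ] ℤ.* ℤ.+ 1 ℤ.≤_) (ℤ.pos-* (suc n) (suc d)) ℤ.-≤+

archimedean : ∀ b c → 0ℚ < c → ∃ λ n → b < fromNat n * c
-- One more than a bound for b / c, to make the inequality strict.
archimedean b c c>0 = suc n , ≤-<-trans b≤nc (<-from-diff (subst (0ℚ <_) (step (fromNat n) c) c>0))
  where
  instance
    c≢0 = >-nonZero c>0
  n = proj₁ (p≤fromNat (b * 1/ c))

  b≤nc : b ≤ fromNat n * c
  b≤nc = ≤-trans
    (≤-reflexive (sym (trans (*-assoc b (1/ c) c) (trans (cong (b *_) (*-inverseˡ c)) (*-identityʳ b)))))
    (*-monoʳ c (<⇒≤ c>0) (proj₂ (p≤fromNat (b * 1/ c))))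

  step : ∀ n c → c ≡ (1ℚ + n) * c - n * c
  step = solve-∀ ring

fromNat-nonneg : ∀ n → 0ℚ ≤ fromNat n
fromNat-nonneg zero    = ≤-refl
fromNat-nonneg (suc n) = +-mono-≤ 0≤1 (fromNat-nonneg n)

module Convergence (q : ℚ) (q>0 : 0ℚ < q) (q<1 : q < 1ℚ) where

  q^≥0 : ∀ n → 0ℚ ≤ q ^ℚ n
  q^≥0 n = <⇒≤ (^-pos q>0 n)

  q^≤1 : ∀ n → q ^ℚ n ≤ 1ℚ
  q^≤1 = ^-≤1 q>0 (<⇒≤ q<1)

  1-q>0 : 0ℚ < 1ℚ - q
  1-q>0 = diff-from-< q<1

  -- The quotient of 1 - q^n by 1 - q is a sum of n powers of `q`, each at least q^n. The
  -- consequence q^n ≤ 1 / (n (1 - q)) for n > 0 is what makes q^n tend to 0.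
  bernoulli : ∀ n → fromNat n * (1ℚ - q) * q ^ℚ n ≤ 1ℚ - q ^ℚ n
  bernoulli zero    = ≤-reflexive (trans (cong (_* 1ℚ) (*-zeroˡ (1ℚ - q))) refl)
  bernoulli (suc n) = ≤-from-diff (subst (0ℚ ≤_) (identity (fromNat n) q (q ^ℚ n))
    (+-mono-≤ (*-nonneg (<⇒≤ q>0) (diff-from-≤ (bernoulli n)))
              (*-nonneg (<⇒≤ 1-q>0) (diff-from-≤ (q^≤1 (suc n))))))
    where
    identity : ∀ m q p → q * (1ℚ - p - m * (1ℚ - q) * p) + (1ℚ - q) * (1ℚ - q * p) ≡
               1ℚ - q * p - (1ℚ + m) * (1ℚ - q) * (q * p)
    identity = solve-∀ ring

  n[1-q]q^n≤1 : ∀ n → fromNat n * (1ℚ - q) * q ^ℚ n ≤ 1ℚ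
  n[1-q]q^n≤1 n = ≤-trans (bernoulli n) (≤-from-diff {1ℚ - q ^ℚ n} {1ℚ} (subst (0ℚ ≤_) (complement (q ^ℚ n)) (q^≥0 n)))
    where
    complement : ∀ p → p ≡ 1ℚ - (1ℚ - p)
    complement = solve-∀ ring

  scaled-bernoulli : ∀ B → 0ℚ ≤ B → ∀ ε n → ε ≤ B * q ^ℚ n → fromNat n * ((1ℚ - q) * ε) ≤ B
  scaled-bernoulli B B≥0 ε n ε≤ = ≤-trans (≤-reflexive (sym (*-assoc (fromNat n) (1ℚ - q) ε)))
    (≤-trans (*-monoˡ (fromNat n * (1ℚ - q)) (*-nonneg (fromNat-nonneg n) (<⇒≤ 1-q>0)) ε≤)
    (≤-trans (≤-reflexive (swap (fromNat n * (1ℚ - q)) B (q ^ℚ n)))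
    (≤-trans (*-monoˡ B B≥0 (n[1-q]q^n≤1 n)) (≤-reflexive (*-identityʳ B)))))
    where
    swap : ∀ a B p → a * (B * p) ≡ B * (a * p)
    swap = solve-∀ ring

  abstract
    q^-small : ∀ B → 0ℚ ≤ B → ∀ ε → 0ℚ < ε → ∃ λ n → B * q ^ℚ n < ε
    q^-small B B≥0 ε ε>0 = let (n , B<) = archimedean B ((1ℚ - q) * ε) (*-pos 1-q>0 ε>0) in
      n , ≰⇒> (λ ε≤ → <-irrefl refl (<-≤-trans B< (scaled-bernoulli B B≥0 ε n ε≤)))

  -- Geometric rather than arbitrary convergence: closed under products without any ε-management.
  record _⟶_ (s : ℕ → ℚ) (r : ℚ) : Set where
    constructor geometrically
    field
      constant : ℚ
      nonneg   : 0ℚ ≤ constant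
      bound    : ∀ t → ∣ s t - r ∣ ≤ constant * q ^ℚ t
  open _⟶_

  ⟶-cong : ∀ {s s′ r r′} → (∀ t → s t ≡ s′ t) → r ≡ r′ → s ⟶ r → s′ ⟶ r′
  ⟶-cong e refl c = geometrically (constant c) (nonneg c)
    (λ t → subst (λ x → ∣ x - _ ∣ ≤ constant c * q ^ℚ t) (e t) (bound c t))

  ⟶-const : ∀ r → (λ _ → r) ⟶ r
  ⟶-const r = geometrically 0ℚ ≤-refl (λ t → ≤-reflexive
    (trans (cong ∣_∣ (+-inverseʳ r)) (sym (*-zeroˡ (q ^ℚ t)))))

  ⟶-+ : ∀ {s s′ r r′} → s ⟶ r → s′ ⟶ r′ → (λ t → s t + s′ t) ⟶ (r + r′)
  ⟶-+ {s} {s′} {r} {r′} c c′ = geometrically (constant c + constant c′) (+-mono-≤ (nonneg c) (nonneg c′)) λ t →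
    ≤-trans (≤-reflexive (cong ∣_∣ (regroup (s t) (s′ t) r r′)))
    (≤-trans (∣p+q∣≤∣p∣+∣q∣ (s t - r) (s′ t - r′))
    (≤-trans (+-mono-≤ (bound c t) (bound c′ t)) (≤-reflexive (sym (*-distribʳ-+ (q ^ℚ t) (constant c) (constant c′))))))
    where
    regroup : ∀ a b c d → a + b - (c + d) ≡ a - c + (b - d)
    regroup = solve-∀ ring

  ⟶-* : ∀ {s s′ r r′} → s ⟶ r → s′ ⟶ r′ → (λ t → s t * s′ t) ⟶ (r * r′)
  ⟶-* {s} {s′} {r} {r′} c c′ = geometrically
    (B * B′ + ∣ r ∣ * B′ + ∣ r′ ∣ * B)
    (+-mono-≤ (+-mono-≤ (*-nonneg (nonneg c) (nonneg c′)) (*-nonneg (0≤∣p∣ r) (nonneg c′)))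
              (*-nonneg (0≤∣p∣ r′) (nonneg c)))
    λ t → ≤-trans (≤-reflexive (cong ∣_∣ (regroup (s t) (s′ t) r r′)))
      (≤-trans (∣p+q∣≤∣p∣+∣q∣ ((s t - r) * (s′ t - r′) + r * (s′ t - r′)) (r′ * (s t - r)))
      (≤-trans (+-mono-≤ (≤-trans (∣p+q∣≤∣p∣+∣q∣ ((s t - r) * (s′ t - r′)) (r * (s′ t - r′)))
                           (+-mono-≤ (first t) (scaled r c′ t))) (scaled r′ c t))
        (≤-reflexive (collect B B′ ∣ r ∣ ∣ r′ ∣ (q ^ℚ t)))))
    where
    B = constant c
    B′ = constant c′

    regroup : ∀ a b c d → a * b - c * d ≡ (a - c) * (b - d) + c * (b - d) + d * (a - c)
    regroup = solve-∀ ring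

    collect : ∀ B C x y p → B * C * p + x * (C * p) + y * (B * p) ≡ (B * C + x * C + y * B) * p
    collect = solve-∀ ring

    scaled : ∀ x {s r} (c : s ⟶ r) t → ∣ x * (s t - r) ∣ ≤ ∣ x ∣ * (constant c * q ^ℚ t)
    scaled x {s} {r} c t = ≤-trans (≤-reflexive (∣p*q∣≡∣p∣*∣q∣ x (s t - r))) (*-monoˡ ∣ x ∣ (0≤∣p∣ x) (bound c t))

    -- The product of the two errors is of order q^(2t); one factor q^t is bounded by 1.
    first : ∀ t → ∣ (s t - r) * (s′ t - r′) ∣ ≤ B * B′ * q ^ℚ t
    first t = ≤-trans (≤-reflexive (∣p*q∣≡∣p∣*∣q∣ (s t - r) (s′ t - r′)))
      (≤-trans (*-monoʳ ∣ s′ t - r′ ∣ (0≤∣p∣ _) (bound c t))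
      (≤-trans (*-monoˡ (B * q ^ℚ t) (*-nonneg (nonneg c) (q^≥0 t))
                 (≤-trans (bound c′ t) (≤-trans (*-monoˡ B′ (nonneg c′) (q^≤1 t)) (≤-reflexive (*-identityʳ B′)))))
        (≤-reflexive (swap B (q ^ℚ t) B′))))
      where
      swap : ∀ a b c → a * b * c ≡ a * c * b
      swap = solve-∀ ring

  ⟶-sum : ∀ {n} {s : ℕ → Fin n → ℚ} {r} → (∀ k → (λ t → s t k) ⟶ r k) → (λ t → sum (s t)) ⟶ sum r
  ⟶-sum {zero}  c = ⟶-const 0ℚ
  ⟶-sum {suc n} c = ⟶-+ (c zero) (⟶-sum (λ k → c (suc k)))

  ⟶-det : ∀ {n} {M : ℕ → Matrix n} {N : Matrix n} → (∀ i j → (λ t → M t i j) ⟶ N i j) →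
          (λ t → det n (M t)) ⟶ det n N
  ⟶-det {zero}          c = ⟶-const 1ℚ
  ⟶-det {suc n} {M} {N} c = ⟶-cong (λ t → sym (det-suc (M t))) (sym (det-suc N))
    (⟶-sum (λ k → ⟶-* (⟶-* (⟶-const (sgn (toℕ k))) (c zero k)) (⟶-det (λ i j → c (suc i) (punchIn k j)))))

  -- A base between 0 and 1 bounds its powers with positive exponent, and here the base is at most
  -- q^t.
  ⟶-power : ∀ m l → (λ t → (q ^ℚ (t ℕ.+ m)) ^ℚ suc l) ⟶ 0ℚ
  ⟶-power m l = geometrically 1ℚ 0≤1 λ t → ≤-trans
    (≤-reflexive (trans (cong ∣_∣ (+-identityʳ _)) (0≤p⇒∣p∣≡p (<⇒≤ (^-pos (^-pos q>0 (t ℕ.+ m)) (suc l))))))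
    (≤-trans (*-monoˡ (q ^ℚ (t ℕ.+ m)) (q^≥0 (t ℕ.+ m)) (^-≤1 (^-pos q>0 (t ℕ.+ m)) (q^≤1 (t ℕ.+ m)) l))
    (≤-trans (≤-reflexive (trans (*-identityʳ _) (trans (^-+ q t m) (*-comm (q ^ℚ t) (q ^ℚ m)))))
             (*-monoʳ (q ^ℚ t) (q^≥0 t) (q^≤1 m))))

-- Sums of families of nonnegative terms

FinitelyBelow : {A : Set} → (A → Set) → (A → ℚ) → ℚ → Set
FinitelyBelow P w R = ∀ L → Unique L → All P L → sumOver w L ≤ R

-- `SumGT` for an arbitrary family, so that the same lemmas serve for patterns and for the sequences
-- ν. For `IsGT` and the weight the two notions agree by definition.
HasSum : {A : Set} → (A → Set) → (A → ℚ) → ℚ → Set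
HasSum {A} P w R =
  FinitelyBelow P w R ×
  (∀ ε → 0ℚ < ε → Σ (List A) λ L → Unique L × All P L × (R - ε < sumOver w L))

unique-map : ∀ {A B : Set} {Q : A → Set} {g : A → B} → (∀ {x y} → Q x → Q y → g x ≡ g y → x ≡ y) →
             ∀ {L} → All Q L → Unique L → Unique (map g L)
unique-map inj []       []       = []
unique-map inj (q ∷ qs) (x≢ ∷ u) =
  All.map⁺ (All.zipWith (λ (qy , x≢y) e → x≢y (inj q qy e)) (qs , x≢)) ∷ unique-map inj qs u

-- The maps need to be inverse only on the two families. The bound `c ≤ 1` lets the same ε serve on
-- both sides.
hasSum-transport : ∀ {A B : Set} {P : A → Set} {Q : B → Set} {w : A → ℚ} {v : B → ℚ} {R} c → 0ℚ < c → c ≤ 1ℚ →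
  (f : A → B) (g : B → A) → (∀ {a} → P a → Q (f a)) → (∀ {b} → Q b → P (g b)) →
  (∀ {a} → P a → g (f a) ≡ a) → (∀ {b} → Q b → f (g b) ≡ b) → (∀ {a} → P a → v (f a) ≡ c * w a) →
  HasSum P w R → HasSum Q v (c * R)
hasSum-transport {A} {B} {P} {Q} {w} {v} {R} c c>0 c≤1 f g Pf Qg gf fg vf (below , approx) = below′ , approx′
  where
  sum-f : ∀ {L} → All P L → sumOver v (map f L) ≡ c * sumOver w L
  sum-f []       = sym (*-zeroʳ c)
  sum-f (p ∷ ps) = trans (cong₂ _+_ (vf p) (sum-f ps)) (sym (*-distribˡ-+ c _ _))

  fg-map : ∀ {L} → All Q L → map f (map g L) ≡ L
  fg-map []       = refl
  fg-map (q ∷ qs) = cong₂ _∷_ (fg q) (fg-map qs)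

  below′ : FinitelyBelow Q v (c * R)
  below′ L u qs = subst (_≤ c * R)
    (trans (sym (sum-f (All.map⁺ (All.map Qg qs)))) (cong (sumOver v) (fg-map qs)))
    (*-monoˡ c (<⇒≤ c>0) (below (map g L)
      (unique-map (λ qx qy e → trans (sym (fg qx)) (trans (cong f e) (fg qy))) qs u)
      (All.map⁺ (All.map Qg qs))))

  approx′ : ∀ ε → 0ℚ < ε → Σ (List B) λ L → Unique L × All Q L × (c * R - ε < sumOver v L)
  approx′ ε ε>0 with approx ε ε>0
  ... | L , u , ps , close = map f L ,
    unique-map (λ px py e → trans (sym (gf px)) (trans (cong g e) (gf py))) ps u ,
    All.map⁺ (All.map Pf ps) ,
    subst (c * R - ε <_) (sym (sum-f ps))
      (<-from-diff (subst (0ℚ <_) (identity c R ε (sumOver w L))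
        (+-mono-<-≤ (*-pos c>0 (diff-from-< close)) (*-nonneg (diff-from-≤ c≤1) (<⇒≤ ε>0)))))
    where
    identity : ∀ c R ε S → c * (S - (R - ε)) + (1ℚ - c) * ε ≡ c * S - (c * R - ε)
    identity = solve-∀ ring

sumOver-filter : ∀ {A : Set} {P : A → Set} (P? : Decidable P) (w : A → ℚ) L →
  sumOver w L ≡ sumOver w (filter P? L) + sumOver w (filter (λ x → ¬? (P? x)) L)
sumOver-filter P? w []      = refl
sumOver-filter P? w (x ∷ L) with P? x
... | yes _ = trans (cong (w x +_) (sumOver-filter P? w L)) (sym (+-assoc (w x) _ _))
... | no  _ = trans (cong (w x +_) (sumOver-filter P? w L)) (swap (w x) (sumOver w (filter P? L)) (sumOver w (filter (λ y → ¬? (P? y)) L)))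
  where
  swap : ∀ a b c → a + (b + c) ≡ b + (a + c)
  swap = solve-∀ ring

module _ {A I : Set} (_≟_ : DecidableEquality I) (κ : A → I) {J : I → Set} {Q : A → Set} {f : I → ℚ} {w : A → ℚ} where

  -- The fibre over the head of `K` is split off from `L`. A repeated element of `K` meets an empty
  -- fibre, and `f i` bounds the empty sum as well.
  sumOver-by-fibres : (∀ i → J i → FinitelyBelow (λ a → Q a × κ a ≡ i) w (f i)) →
    ∀ K → All J K → ∀ L → Unique L → All Q L → All (λ a → κ a ∈ K) L → sumOver w L ≤ sumOver f K
  sumOver-by-fibres fib []      []       []      u qs []       = ≤-refl
  sumOver-by-fibres fib []      []       (a ∷ L) u qs (() ∷ _)
  sumOver-by-fibres fib (i ∷ K) (ji ∷ js) L u qs κ∈ = ≤-trans (≤-reflexive (sumOver-filter at? w L))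
    (+-mono-≤
      (fib i ji (filter at? L) (Unique.filter⁺ at? u)
        (All.zip (All.filter⁺ at? qs , All.all-filter at? L)))
      (sumOver-by-fibres fib K js (filter off? L) (Unique.filter⁺ off? u) (All.filter⁺ off? qs)
        (All.zipWith (λ { (here e , ≢i) → ⊥-elim (≢i e) ; (there m , _) → m })
          (All.filter⁺ off? κ∈ , All.all-filter off? L))))
    where
    at? : Decidable (λ a → κ a ≡ i)
    at? a = κ a ≟ i
    off? : Decidable (λ a → ¬ κ a ≡ i)
    off? a = ¬? (at? a)

  -- Half of the tolerance is spent on the head of `K` and half on its tail.
  approximate-fibres : (∀ i → J i → HasSum (λ a → Q a × κ a ≡ i) w (f i)) →
    ∀ K → Unique K → All J K → ∀ ε → 0ℚ < ε →
    Σ (List A) λ L → Unique L × All (λ a → Q a × κ a ∈ K) L × (sumOver f K - ε < sumOver w L)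
  approximate-fibres fib []      _        _         ε ε>0 =
    [] , [] , [] , <-from-diff (subst (0ℚ <_) (neg-neg ε) ε>0)
    where
    neg-neg : ∀ ε → ε ≡ 0ℚ - (0ℚ - ε)
    neg-neg = solve-∀ ring
  approximate-fibres fib (i ∷ K) (i∉ ∷ u) (ji ∷ js) ε ε>0
    with proj₂ (fib i ji) (½ * ε) (*-pos (positive⁻¹ ½) ε>0)
       | approximate-fibres fib K u js (½ * ε) (*-pos (positive⁻¹ ½) ε>0)
  ... | L₁ , u₁ , q₁ , close₁ | L₂ , u₂ , q₂ , close₂ =
    L₁ ++ L₂ ,
    Unique.++⁺ u₁ u₂ (λ (a∈₁ , a∈₂) → All.lookup i∉ (proj₂ (All.lookup q₂ a∈₂)) (sym (proj₂ (All.lookup q₁ a∈₁)))) ,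
    All.++⁺ (All.map (λ (q , e) → q , here e) q₁) (All.map (λ (q , m) → q , there m) q₂) ,
    subst₂ _<_ (trans (regroup (f i) (sumOver f K) (½ * ε)) (cong (λ x → f i + sumOver f K - x) halves))
      (sym (sumOver-++ w L₁ L₂)) (+-mono-< close₁ close₂)
    where
    regroup : ∀ a b e → a - e + (b - e) ≡ a + b - (e + e)
    regroup = solve-∀ ring
    halves : ½ * ε + ½ * ε ≡ ε
    halves = trans (sym (*-distribʳ-+ ε ½ ½)) (*-identityˡ ε)

  -- Tonelli's theorem in terms of finite sums. A finite list meets finitely many fibres, which
  -- gives the bound; conversely, finitely many values `f i` come close to `R`, and a finite part of
  -- each of these fibres comes close to `f i`.
  hasSum-by-fibres : ∀ {R} → HasSum J f R → (∀ i → J i → HasSum (λ a → Q a × κ a ≡ i) w (f i)) →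
    (∀ {a} → Q a → J (κ a)) → HasSum Q w R
  hasSum-by-fibres {R} (below , approx) fib J-κ = below′ , approx′
    where
    below′ : FinitelyBelow Q w R
    below′ L u qs = ≤-trans
      (sumOver-by-fibres (λ i ji → proj₁ (fib i ji)) K J-K L u qs
        (All.tabulate (λ a∈ → ∈-deduplicate⁺ _≟_ (∈-map⁺ κ a∈))))
      (below K (deduplicate-! _≟_ (map κ L)) J-K)
      where
      K = deduplicate _≟_ (map κ L)
      J-K : All J K
      J-K = All.deduplicate⁺ _≟_ (All.map⁺ (All.map J-κ qs))

    approx′ : ∀ ε → 0ℚ < ε → Σ (List A) λ L → Unique L × All Q L × (R - ε < sumOver w L)
    approx′ ε ε>0 with approx (½ * ε) (*-pos (positive⁻¹ ½) ε>0)
    ... | K , u , js , close with approximate-fibres fib K u js (½ * ε) (*-pos (positive⁻¹ ½) ε>0)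
    ...   | L , u′ , qs , close′ = L , u′ , All.map proj₁ qs ,
      <-trans (subst (_< sumOver f K - ½ * ε)
                (trans (regroup R (½ * ε)) (cong (λ x → R - x) (trans (sym (*-distribʳ-+ ε ½ ½)) (*-identityˡ ε))))
                (+-monoˡ-< (- (½ * ε)) close)) close′
      where
      regroup : ∀ a e → a - e - e ≡ a - (e + e)
      regroup = solve-∀ ring

module _ {I : Set} (_≟_ : DecidableEquality I) {J : I → Set} {f : I → ℚ} (f≥0 : ∀ i → J i → 0ℚ ≤ f i) where

  -- The fibres of the identity map are single points.
  sumOver-⊆ : ∀ K K′ → All J K′ → Unique K → All (_∈ K′) K → sumOver f K ≤ sumOver f K′
  sumOver-⊆ K K′ js u K⊆ = sumOver-by-fibres _≟_ (λ i → i) {J = J} {Q = J} single K′ js K u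
    (All.map (All.lookup js) K⊆) K⊆
    where
    single : ∀ i → J i → FinitelyBelow (λ a → J a × a ≡ i) f (f i)
    single i ji []          _                  _                             = f≥0 i ji
    single i ji (a ∷ [])    _                  ((_ , refl) ∷ [])             = ≤-reflexive (+-identityʳ (f i))
    single i ji (a ∷ b ∷ L) ((a≢b ∷ _) ∷ _) ((_ , refl) ∷ (_ , refl) ∷ _) = ⊥-elim (a≢b refl)

  module Exhaustion (q : ℚ) (q>0 : 0ℚ < q) (q<1 : q < 1ℚ) where
    open Convergence q q>0 q<1
    open _⟶_

    -- Monotone convergence: every finite part of the family lies in one of the growing lists, and
    -- the sums over these increase to `R`.
    hasSum-by-exhaustion : ∀ {R} (L : ℕ → List I) → (∀ t → Unique (L t)) → (∀ t → All J (L t)) →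
      (∀ {t i} → i ∈ L t → i ∈ L (suc t)) → (∀ {i} → J i → ∃ λ t → i ∈ L t) →
      (λ t → sumOver f (L t)) ⟶ R → HasSum J f R
    hasSum-by-exhaustion {R} L u js grow cover conv = below , approx
      where
      grow* : ∀ k {t i} → i ∈ L t → i ∈ L (k ℕ.+ t)
      grow* zero    i∈ = i∈
      grow* (suc k) i∈ = grow (grow* k i∈)

      monotone : ∀ k t → sumOver f (L t) ≤ sumOver f (L (k ℕ.+ t))
      monotone k t = sumOver-⊆ (L t) (L (k ℕ.+ t)) (js (k ℕ.+ t)) (u t) (All.tabulate (grow* k))

      close : ∀ ε → 0ℚ < ε → ∃ λ t → ∀ k → ∣ sumOver f (L (k ℕ.+ t)) - R ∣ < ε
      close ε ε>0 with q^-small (constant conv) (nonneg conv) ε ε>0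
      ... | t , small = t , λ k → ≤-<-trans (≤-trans (bound conv (k ℕ.+ t))
        (*-monoˡ (constant conv) (nonneg conv) (≤-trans (≤-reflexive (^-+ q k t))
          (≤-trans (*-monoʳ (q ^ℚ t) (q^≥0 t) (q^≤1 k)) (≤-reflexive (*-identityˡ _)))))) small

      partial : ∀ t → sumOver f (L t) ≤ R
      partial t with R <? sumOver f (L t)
      ... | no ¬R< = ≮⇒≥ ¬R<
      -- An excess over `R` would persist in all later sums, against their convergence to `R`.
      ... | yes R< with close (sumOver f (L t) - R) (diff-from-< R<)
      ...   | t′ , near = ⊥-elim (<-irrefl refl (<-≤-trans (near t)
              (≤-trans (+-monoˡ-≤ (- R) (subst (λ m → sumOver f (L t) ≤ sumOver f (L m)) (ℕ.+-comm t′ t) (monotone t′ t)))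
                       (p≤∣p∣ _))))

      covered : ∀ {K} → All J K → ∃ λ t → All (_∈ L t) K
      covered []        = 0 , []
      covered (j ∷ js′) with cover j | covered js′
      ... | t , i∈ | t′ , is∈ = t′ ℕ.+ t ,
        grow* t′ i∈ ∷ All.map (λ {x} x∈ → subst (λ m → x ∈ L m) (ℕ.+-comm t t′) (grow* t x∈)) is∈

      below : FinitelyBelow J f R
      below K uK jK with covered jK
      ... | t , K⊆ = ≤-trans (sumOver-⊆ K (L t) (js t) uK K⊆) (partial t)

      approx : ∀ ε → 0ℚ < ε → Σ (List I) λ K → Unique K × All J K × (R - ε < sumOver f K)
      approx ε ε>0 with close ε ε>0
      ... | t , near = L t , u t , js t , <-from-diff (subst (0ℚ <_) (regroup ε R _) (diff-from-<
            (≤-<-trans (≤-trans (p≤∣p∣ _)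
              (≤-reflexive (trans (cong ∣_∣ (flip R (sumOver f (L t)))) (∣-p∣≡∣p∣ (sumOver f (L t) - R))))) (near 0))))
        where
        flip : ∀ R s → R - s ≡ - (s - R)
        flip = solve-∀ ring
        regroup : ∀ ε R s → ε - (R - s) ≡ s - (R - ε)
        regroup = solve-∀ ring

-- Summation over patterns

divQ-* : ∀ p r → r ≢ 0ℚ → divQ p r * r ≡ p
divQ-* p r r≢0 with r ≟ 0ℚ
... | yes r≡0 = ⊥-elim (r≢0 r≡0)
... | no  r≢0′ = trans (*-assoc p (1/ r) r) (trans (cong (p *_) (*-inverseˡ r)) (*-identityʳ p))
  where
  instance
    r-nonZero : NonZero r
    r-nonZero = ≢-nonZero r≢0′

*-cancelʳ : ∀ {x y} r → r ≢ 0ℚ → x * r ≡ y * r → x ≡ y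
*-cancelʳ {x} {y} r r≢0 e = begin
  x                  ≡⟨ undo x ⟨
  x * r * 1/ r       ≡⟨ cong (_* 1/ r) e ⟩
  y * r * 1/ r       ≡⟨ undo y ⟩
  y                  ∎
  where
  instance
    r-nonZero : NonZero r
    r-nonZero = ≢-nonZero r≢0

  undo : ∀ z → z * r * 1/ r ≡ z
  undo z = trans (*-assoc z r (1/ r)) (trans (cong (z *_) (*-inverseʳ r)) (*-identityʳ z))

divQ-unique : ∀ {x} p r → r ≢ 0ℚ → x * r ≡ p → x ≡ divQ p r
divQ-unique p r r≢0 e = *-cancelʳ r r≢0 (trans e (sym (divQ-* p r r≢0)))

*-divQ : ∀ c p r → r ≢ 0ℚ → c * divQ p r ≡ divQ (c * p) r
*-divQ c p r r≢0 = divQ-unique (c * p) r r≢0 (trans (*-assoc c (divQ p r) r) (cong (c *_) (divQ-* p r r≢0)))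

pos⇒≢0 : ∀ {p} → 0ℚ < p → p ≢ 0ℚ
pos⇒≢0 p>0 e = <⇒≢ p>0 (sym e)

prod-pos : ∀ {n} {f : Fin n → ℚ} → (∀ i → 0ℚ < f i) → 0ℚ < prod f
prod-pos {zero}  h = positive⁻¹ 1ℚ
prod-pos {suc n} h = *-pos (h zero) (prod-pos (λ i → h (suc i)))

prodR-pos : ∀ n {f : ℕ → ℚ} → (∀ i → 1 ℕ.≤ i → i ℕ.≤ n → 0ℚ < f i) → 0ℚ < prodR n f
prodR-pos zero    h = positive⁻¹ 1ℚ
prodR-pos (suc n) h = *-pos (prodR-pos n (λ i 1≤i i≤n → h i 1≤i (ℕ.m≤n⇒m≤1+n i≤n))) (h (suc n) (s≤s z≤n) ℕ.≤-refl)

sumOver-cong-All : ∀ {A : Set} {f g : A → ℚ} {xs} → All (λ x → f x ≡ g x) xs → sumOver f xs ≡ sumOver g xs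
sumOver-cong-All []       = refl
sumOver-cong-All (e ∷ es) = cong₂ _+_ e (sumOver-cong-All es)

hasSum-⇔ : ∀ {A : Set} {P Q : A → Set} {w R} → (∀ {a} → P a → Q a) → (∀ {a} → Q a → P a) → HasSum P w R → HasSum Q w R
hasSum-⇔ P⇒Q Q⇒P (below , approx) =
  (λ L u qs → below L u (All.map Q⇒P qs)) ,
  (λ ε ε>0 → let (L , u , ps , close) = approx ε ε>0 in L , u , All.map P⇒Q ps , close)

hasSum-singleton : ∀ {A : Set} {P : A → Set} {w : A → ℚ} a → P a → (∀ {b} → P b → b ≡ a) → 0ℚ ≤ w a → HasSum P w (w a)
hasSum-singleton {A} {P} {w} a pa only w≥0 = below , approx
  where
  below : FinitelyBelow P w (w a)
  below []          _               _             = w≥0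
  below (b ∷ [])    _               (pb ∷ [])     = ≤-reflexive (trans (+-identityʳ (w b)) (cong w (only pb)))
  below (b ∷ c ∷ L) ((b≢c ∷ _) ∷ _) (pb ∷ pc ∷ _) = ⊥-elim (b≢c (trans (only pb) (sym (only pc))))

  approx : ∀ ε → 0ℚ < ε → Σ (List A) λ L → Unique L × All P L × (w a - ε < sumOver w L)
  approx ε ε>0 = a ∷ [] , [] ∷ [] , pa ∷ [] , <-from-diff (subst (0ℚ <_) (regroup (w a) ε) ε>0)
    where
    regroup : ∀ a ε → ε ≡ a + 0ℚ - (a - ε)
    regroup = solve-∀ ring

interlaces-ascending : ∀ {m n μ ν} → m ℕ.≤ n → Interlaces m n μ ν → Ascending ν
interlaces-ascending m≤n int a 1+a< = ℕ.≤-trans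
  (upper a (ℕ.<-trans (ℕ.n<1+n a) 1+a<m) (ℕ.<-≤-trans 1+a<m m≤n)) (lower (suc a) 1+a<m)
  where
  open Interlaces int
  1+a<m = subst (suc a ℕ.<_) length≡ 1+a<

-- In the unbounded case the determinant gains a column, which has to consist of ones; `cut` gives
-- it the exponent 0 whatever `l n` is.
cut : ℕ → (ℕ → ℕ) → ℕ → ℕ
cut n l b with b ℕ.<? n
... | yes _ = l b
... | no  _ = 0

cut-< : ∀ {n} l {b} → b ℕ.< n → cut n l b ≡ l b
cut-< {n} l {b} b<n with b ℕ.<? n
... | yes _ = refl
... | no b≮n = ⊥-elim (b≮n b<n)

cut-self : ∀ n l → cut n l n ≡ 0
cut-self n l with n ℕ.<? n
... | yes n<n = ⊥-elim (ℕ.<-irrefl refl n<n)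
... | no  _   = refl

alternant-cong : ∀ q n {μ ν : List ℕ} {l l′ : ℕ → ℕ} →
  (∀ a → a ℕ.< n → nthD μ a ≡ nthD ν a) → (∀ b → b ℕ.< n → l b ≡ l′ b) →
  alternant q n μ l ≡ alternant q n ν l′
alternant-cong q n μ≡ν l≡l′ = det-cong (λ a b →
  cong₂ (λ x y → (q ^ℚ (x ℕ.+ toℕ a)) ^ℚ y) (μ≡ν (toℕ a) (toℕ<n a)) (l≡l′ (toℕ b) (toℕ<n b)))

StrictlyDescending : ℕ → (ℕ → ℕ) → Set
StrictlyDescending n l = ∀ a → suc a ℕ.< n → l (suc a) ℕ.< l a

last-least : ∀ {n l} → StrictlyDescending (suc n) l → ∀ k {a} → k ℕ.+ a ≡ n → l n ℕ.≤ l a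
last-least         desc zero        refl = ℕ.≤-refl
last-least {n} {l} desc (suc k) {a} e    =
  ℕ.≤-trans (last-least desc k (trans (ℕ.+-suc k a) e))
            (ℕ.<⇒≤ (desc a (s≤s (subst (suc a ℕ.≤_) e (s≤s (ℕ.m≤n+m a k))))))

module PatternSum (q : ℚ) (q>0 : 0ℚ < q) (q<1 : q < 1ℚ) where
  open Convergence q q>0 q<1
  open Pattern
  open Interlaces

  wt : List (List ℕ) → ℚ
  wt T = q ^ℚ weight T

  1-q^>0 : ∀ {k} → 1 ℕ.≤ k → 0ℚ < 1ℚ - q ^ℚ k
  1-q^>0 {suc k} _ = diff-from-< (≤-<-trans
    (≤-trans (*-monoˡ q (<⇒≤ q>0) (q^≤1 k)) (≤-reflexive (*-identityʳ q))) q<1)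

  qPoch-pos : ∀ k → 0ℚ < qPoch q k
  qPoch-pos k = prodR-pos k (λ i 1≤i _ → 1-q^>0 1≤i)

  -- When every l_b grows by one, the powers of q gain the factor `stair`, and the q-factorials gain
  -- the denominators 1 - q^(l_b) of the geometric sums; see `norm-shift`.
  norm : ℕ → (ℕ → ℕ) → ℚ
  norm n l = prod {n} (λ b → (q ^ℚ toℕ b) ^ℚ l (toℕ b) * qPoch q (l (toℕ b)))

  norm≢0 : ∀ n l → norm n l ≢ 0ℚ
  norm≢0 n l = pos⇒≢0 (prod-pos {n} (λ b → *-pos (^-pos (^-pos q>0 (toℕ b)) (l (toℕ b))) (qPoch-pos (l (toℕ b)))))

  value : ℕ → (ℕ → ℕ) → List ℕ → ℚ
  value n l μ = divQ (q ^ℚ total μ * alternant q n μ l) (norm n l)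

  prod-q^ : ∀ {n} ν → length ν ≡ n → prod {n} (λ a → q ^ℚ nthD ν (toℕ a)) ≡ q ^ℚ total ν
  prod-q^ []      refl = refl
  prod-q^ (x ∷ ν) refl = trans (cong (q ^ℚ x *_) (prod-q^ ν refl)) (sym (^-+ q x (total ν)))

  stair : ℕ → ℚ
  stair n = prod {n} (λ a → q ^ℚ toℕ a)

  module _ (m : ℕ) (l : ℕ → ℕ) (tall : ∀ {a} → a ℕ.< m → 1 ℕ.≤ l a) where

    l⁻ : ℕ → ℕ
    l⁻ a = l a ∸ 1

    l≡ : ∀ (b : Fin m) → l (toℕ b) ≡ suc (l⁻ (toℕ b))
    l≡ b = sym (ℕ.m+[n∸m]≡n (tall (toℕ<n b)))

    -- One factor is taken out of every row. The product of these factors contains the power q^|ν|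
    -- that occurs in `value`, so the sum over ν becomes a sum of bare determinants.
    alternant-shift : ∀ ν → length ν ≡ m → alternant q m ν l ≡ q ^ℚ total ν * stair m * alternant q m ν l⁻
    alternant-shift ν |ν| = begin
      alternant q m ν l
        ≡⟨ det-cong (λ a b → cong (y a ^ℚ_) (l≡ b)) ⟩
      det m (λ a b → y a * y a ^ℚ l⁻ (toℕ b))
        ≡⟨ det-scale-rows y (λ a b → y a ^ℚ l⁻ (toℕ b)) ⟩
      prod y * alternant q m ν l⁻
        ≡⟨ cong (_* alternant q m ν l⁻) (begin
             prod y
               ≡⟨ prod-cong {m} (λ a → ^-+ q (nthD ν (toℕ a)) (toℕ a)) ⟩
             prod {m} (λ a → q ^ℚ nthD ν (toℕ a) * q ^ℚ toℕ a)
               ≡⟨ prod-distrib-* {m} (λ a → q ^ℚ nthD ν (toℕ a)) (λ a → q ^ℚ toℕ a) ⟩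
             prod {m} (λ a → q ^ℚ nthD ν (toℕ a)) * stair m
               ≡⟨ cong (_* stair m) (prod-q^ ν |ν|) ⟩
             q ^ℚ total ν * stair m ∎) ⟩
      q ^ℚ total ν * stair m * alternant q m ν l⁻ ∎
      where
      y : Fin m → ℚ
      y a = q ^ℚ (nthD ν (toℕ a) ℕ.+ toℕ a)

    norm-shift : norm m l ≡ norm m l⁻ * stair m * prod {m} (λ b → 1ℚ - q ^ℚ l (toℕ b))
    norm-shift = begin
      norm m l
        ≡⟨ prod-cong {m} (λ b → begin
             (q ^ℚ toℕ b) ^ℚ l (toℕ b) * qPoch q (l (toℕ b))
               ≡⟨ cong (λ k → (q ^ℚ toℕ b) ^ℚ k * qPoch q k) (l≡ b) ⟩
             q ^ℚ toℕ b * (q ^ℚ toℕ b) ^ℚ l⁻ (toℕ b) * (qPoch q (l⁻ (toℕ b)) * (1ℚ - q ^ℚ suc (l⁻ (toℕ b))))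
               ≡⟨ rearrange (q ^ℚ toℕ b) ((q ^ℚ toℕ b) ^ℚ l⁻ (toℕ b)) (qPoch q (l⁻ (toℕ b))) (1ℚ - q ^ℚ suc (l⁻ (toℕ b))) ⟩
             f b * q ^ℚ toℕ b * (1ℚ - q ^ℚ suc (l⁻ (toℕ b)))
               ≡⟨ cong (λ k → f b * q ^ℚ toℕ b * (1ℚ - q ^ℚ k)) (l≡ b) ⟨
             f b * q ^ℚ toℕ b * (1ℚ - q ^ℚ l (toℕ b)) ∎) ⟩
      prod {m} (λ b → f b * q ^ℚ toℕ b * (1ℚ - q ^ℚ l (toℕ b)))
        ≡⟨ prod-distrib-* {m} (λ b → f b * q ^ℚ toℕ b) (λ b → 1ℚ - q ^ℚ l (toℕ b)) ⟩
      prod {m} (λ b → f b * q ^ℚ toℕ b) * prod {m} (λ b → 1ℚ - q ^ℚ l (toℕ b))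
        ≡⟨ cong (_* prod {m} (λ b → 1ℚ - q ^ℚ l (toℕ b))) (prod-distrib-* {m} f (λ b → q ^ℚ toℕ b)) ⟩
      norm m l⁻ * stair m * prod {m} (λ b → 1ℚ - q ^ℚ l (toℕ b)) ∎
      where
      f : Fin m → ℚ
      f b = (q ^ℚ toℕ b) ^ℚ l⁻ (toℕ b) * qPoch q (l⁻ (toℕ b))

      rearrange : ∀ a b c d → a * b * (c * d) ≡ b * c * a * d
      rearrange = solve-∀ ring

    value-alternant : ∀ ν → length ν ≡ m → value m l⁻ ν * (norm m l⁻ * stair m) ≡ alternant q m ν l
    value-alternant ν |ν| = begin
      value m l⁻ ν * (norm m l⁻ * stair m)
        ≡⟨ *-assoc (value m l⁻ ν) (norm m l⁻) (stair m) ⟨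
      value m l⁻ ν * norm m l⁻ * stair m
        ≡⟨ cong (_* stair m) (divQ-* (q ^ℚ total ν * alternant q m ν l⁻) (norm m l⁻) (norm≢0 m l⁻)) ⟩
      q ^ℚ total ν * alternant q m ν l⁻ * stair m
        ≡⟨ swap (q ^ℚ total ν) (alternant q m ν l⁻) (stair m) ⟩
      q ^ℚ total ν * stair m * alternant q m ν l⁻
        ≡⟨ alternant-shift ν |ν| ⟨
      alternant q m ν l ∎
      where
      swap : ∀ a b c → a * b * c ≡ a * c * b
      swap = solve-∀ ring

    -- The exponents `l⁰` are `l` itself if the last column disappears, and `cut m l` if `μ` has
    -- been extended by an auxiliary part.
    layer-sum : ∀ μ l⁰ → length μ ≡ suc m → Ascending μ → (∀ b → b ℕ.< m → l⁰ b ≡ l b) → l⁰ m ≡ 0 →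
      sumOver (value m l⁻) (interlacing μ) ≡ divQ (alternant q (suc m) μ l⁰) (norm m l)
    layer-sum μ l⁰ |μ| asc l⁰≡l l⁰m = divQ-unique _ (norm m l) (norm≢0 m l) (begin
      sumOver (value m l⁻) (interlacing μ) * norm m l
        ≡⟨ cong (sumOver (value m l⁻) (interlacing μ) *_) norm-shift ⟩
      sumOver (value m l⁻) (interlacing μ) * (c * P)
        ≡⟨ *-assoc (sumOver (value m l⁻) (interlacing μ)) c P ⟨
      sumOver (value m l⁻) (interlacing μ) * c * P
        ≡⟨ cong (_* P) (sumOver-*ʳ c (value m l⁻) (interlacing μ)) ⟨
      sumOver (λ ν → value m l⁻ ν * c) (interlacing μ) * P
        ≡⟨ cong₂ _*_ (sumOver-cong-All (All.tabulate (λ {ν} ν∈ → trans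
             (value-alternant ν (length≡ (∈-interlacing⁻ μ |μ| asc ν∈)))
             (alternant-cong q m {ν} {ν} (λ _ _ → refl) (λ b b<m → sym (l⁰≡l b b<m))))))
             (prod-cong {m} (λ b → cong (λ k → 1ℚ - q ^ℚ k) (sym (l⁰≡l (toℕ b) (toℕ<n b))))) ⟩
      sumOver (λ ν → alternant q m ν l⁰) (interlacing μ) * prod {m} (λ b → 1ℚ - q ^ℚ l⁰ (toℕ b))
        ≡⟨ interlacing-sum q m μ l⁰ |μ| asc l⁰m ⟩
      alternant q (suc m) μ l⁰ ∎)
      where
      c = norm m l⁻ * stair m
      P = prod {m} (λ b → 1ℚ - q ^ℚ l (toℕ b))

  Summable : ℕ → (ℕ → ℕ) → Set
  Summable n l = ∀ μ → length μ ≡ n → Ascending μ → HasSum (Pattern n l μ) wt (value n l μ)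

  _≟ᴸ_ : DecidableEquality (List ℕ)
  _≟ᴸ_ = ≡-dec ℕ._≟_

  module _ (m n : ℕ) (l : ℕ → ℕ) (μ : List ℕ) (|μ| : length μ ≡ n) (m≤n : m ℕ.≤ n) (n≤1+m : n ℕ.≤ suc m)
           (tall : ∀ {a} → a ℕ.< m → 1 ℕ.≤ l a) (short : ∀ {a} → m ℕ.≤ a → a ℕ.< n → l a ≡ 0)
           (ih : Summable m (λ a → l a ∸ 1)) where
    open Layer m n l μ |μ| m≤n n≤1+m tall short

    ih′ : ∀ {ν} → Interlaces m n μ ν → HasSum (Pattern m l′ ν) wt (value m l′ ν)
    ih′ {ν} int = ih ν (length≡ int) (interlaces-ascending m≤n int)

    value-nonneg : ∀ ν → Interlaces m n μ ν → 0ℚ ≤ value m l′ ν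
    value-nonneg ν int = proj₁ (ih′ int) [] [] []

    -- The removed diagonal has weight q^|μ|. The remaining patterns are grouped by their own
    -- diagonal ν, and the induction hypothesis evaluates each group.
    hasSum-layer : ∀ {R} → HasSum (Interlaces m n μ) (value m l′) R → HasSum (Pattern n l μ) wt (q ^ℚ total μ * R)
    hasSum-layer h = hasSum-transport (q ^ℚ total μ) (^-pos q>0 (total μ)) (q^≤1 (total μ)) (glue μ) (peel m)
      glue-pattern peel-inner
      (λ {T} (pat , _) → peel-glue m μ T (columns pat) (subst (m ℕ.≤_) (sym |μ|) m≤n))
      glue-peel
      (λ {T} (pat , _) → trans
        (cong (q ^ℚ_) (weight-glue μ T (subst₂ ℕ._≤_ (sym (columns pat)) (sym |μ|) m≤n)))
        (^-+ q (total μ) (weight T)))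
      (hasSum-by-fibres _≟ᴸ_ bottom {J = Interlaces m n μ} {Q = Inner} h
        (λ ν int → hasSum-⇔ {P = Pattern m l′ ν}
          (λ {T} pat → (subst (λ κ → Pattern m l′ κ T) (sym (base pat)) pat ,
                        subst (Interlaces m n μ) (sym (base pat)) int) , base pat)
          (λ { ((pat , _) , refl) → pat })
          (ih′ int))
        proj₂)

  summable-zero : ∀ l → Summable 0 l
  -- `value 0 l []` evaluates to 1, the weight of the empty pattern.
  summable-zero l [] refl asc = hasSum-singleton {w = wt} []
    (record { columns = refl ; heights = λ _ () ; vertical = λ _ _ () ; horizontal = λ _ _ () ; base = refl })
    (λ {T} pat → empty T (columns pat)) 0≤1
    where
    empty : ∀ (T : List (List ℕ)) → length T ≡ 0 → T ≡ []
    empty [] _ = refl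

  summable-short : ∀ n l → StrictlyDescending (suc n) l → l n ≡ 0 → Summable n (λ a → l a ∸ 1) → Summable (suc n) l
  summable-short n l desc ln≡0 ih μ |μ| asc = subst (HasSum (Pattern (suc n) l μ) wt)
    (trans (*-divQ (q ^ℚ total μ) (alternant q (suc n) μ l) (norm n l) (norm≢0 n l))
           (cong (divQ (q ^ℚ total μ * alternant q (suc n) μ l)) (sym norm-short)))
    (hasSum-layer n (suc n) l μ |μ| (ℕ.n≤1+n n) ℕ.≤-refl tall short ih
      -- There are finitely many ν here, so the exhaustion is constant.
      (hasSum-by-exhaustion (λ _ → interlacing μ) (λ _ → interlacing-unique μ)
        (λ _ → All.tabulate (∈-interlacing⁻ μ |μ| asc)) (λ ν∈ → ν∈) (λ {ν} int → 0 , ∈-interlacing⁺ μ ν |μ| int)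
        (⟶-cong (λ _ → sym (layer-sum n l tall μ l |μ| asc (λ _ _ → refl) ln≡0)) refl (⟶-const _))))
    where
    tall : ∀ {a} → a ℕ.< n → 1 ℕ.≤ l a
    tall {a} a<n = ℕ.≤-trans (s≤s z≤n) (desc a (s≤s a<n))

    short : ∀ {a} → n ℕ.≤ a → a ℕ.< suc n → l a ≡ 0
    short n≤a a<1+n = trans (cong l (ℕ.≤-antisym (s≤s⁻¹ a<1+n) n≤a)) ln≡0

    open Exhaustion _≟ᴸ_ (value-nonneg n (suc n) l μ |μ| (ℕ.n≤1+n n) ℕ.≤-refl tall short ih) q q>0 q<1

    norm-short : norm (suc n) l ≡ norm n l
    norm-short = trans (prod-init-last {n} (λ b → (q ^ℚ toℕ b) ^ℚ l (toℕ b) * qPoch q (l (toℕ b)))) (trans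
      (cong₂ _*_
        (prod-cong {n} (λ b → cong (λ i → (q ^ℚ i) ^ℚ l i * qPoch q (l i)) (toℕ-inject₁ b)))
        (trans (cong (λ i → (q ^ℚ i) ^ℚ l i * qPoch q (l i)) (toℕ-fromℕ n))
               (cong (λ k → (q ^ℚ n) ^ℚ k * qPoch q k) ln≡0)))
      (*-identityʳ (norm n l)))

  -- As the extra part grows, its row of the alternant tends to (0, …, 0, 1).
  alternant-limit : ∀ n l μ → length μ ≡ n → (∀ {a} → a ℕ.< n → 1 ℕ.≤ l a) → ∀ s →
    (λ t → alternant q (suc n) (μ ++ (t ℕ.+ s) ∷ []) (cut n l)) ⟶ alternant q n μ l
  alternant-limit n l μ |μ| tall s = ⟶-cong (λ _ → refl)
    (trans (det-unit-last-row N
      (λ j → trans (N-last _ (toℕ-fromℕ n)) (N′-left (subst (ℕ._< n) (sym (toℕ-inject₁ j)) (toℕ<n j))))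
      (trans (N-last _ (toℕ-fromℕ n)) (N′-right (toℕ-fromℕ n))))
      (det-cong (λ a b → trans (N-upper (inject₁ a) (inject₁ b) (subst (ℕ._< n) (sym (toℕ-inject₁ a)) (toℕ<n a)))
        (cong₂ (λ i k → (q ^ℚ (nthD μ i ℕ.+ i)) ^ℚ k) (toℕ-inject₁ a)
          (trans (cong (cut n l) (toℕ-inject₁ b)) (cut-< l (toℕ<n b)))))))
    (⟶-det entry⟶)
    where
    N′ : ℕ → ℚ
    N′ j with j ℕ.<? n
    ... | yes _ = 0ℚ
    ... | no  _ = 1ℚ

    N : Matrix (suc n)
    N a b with toℕ a ℕ.<? n
    ... | yes _ = (q ^ℚ (nthD μ (toℕ a) ℕ.+ toℕ a)) ^ℚ cut n l (toℕ b)
    ... | no  _ = N′ (toℕ b)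

    N-upper : ∀ a b → toℕ a ℕ.< n → N a b ≡ (q ^ℚ (nthD μ (toℕ a) ℕ.+ toℕ a)) ^ℚ cut n l (toℕ b)
    N-upper a b a<n with toℕ a ℕ.<? n
    ... | yes _   = refl
    ... | no  a≮n = ⊥-elim (a≮n a<n)

    N-last : ∀ {a} b → toℕ a ≡ n → N a b ≡ N′ (toℕ b)
    N-last {a} b a≡n with toℕ a ℕ.<? n
    ... | yes a<n = ⊥-elim (ℕ.<-irrefl a≡n a<n)
    ... | no  _   = refl

    N′-left : ∀ {j} → j ℕ.< n → N′ j ≡ 0ℚ
    N′-left {j} j<n with j ℕ.<? n
    ... | yes _   = refl
    ... | no  j≮n = ⊥-elim (j≮n j<n)

    N′-right : ∀ {j} → j ≡ n → N′ j ≡ 1ℚ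
    N′-right {j} j≡n with j ℕ.<? n
    ... | yes j<n = ⊥-elim (ℕ.<-irrefl j≡n j<n)
    ... | no  _   = refl

    at-end : ∀ t {a} → a ≡ n → nthD (μ ++ (t ℕ.+ s) ∷ []) a ≡ t ℕ.+ s
    at-end t a≡n = trans (cong (nthD (μ ++ (t ℕ.+ s) ∷ [])) (trans a≡n (sym |μ|))) (nthD-++-last μ (t ℕ.+ s))

    entry⟶ : ∀ a b → (λ t → (q ^ℚ (nthD (μ ++ (t ℕ.+ s) ∷ []) (toℕ a) ℕ.+ toℕ a)) ^ℚ cut n l (toℕ b)) ⟶ N a b
    entry⟶ a b with toℕ a ℕ.<? n
    ... | yes a<n = ⟶-cong
      (λ t → cong (λ x → (q ^ℚ (x ℕ.+ toℕ a)) ^ℚ cut n l (toℕ b))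
        (sym (nthD-++ˡ μ _ (toℕ a) (subst (toℕ a ℕ.<_) (sym |μ|) a<n)))) refl (⟶-const _)
    ... | no  a≮n with toℕ b ℕ.<? n
    -- The exponent `l b` is at least 1, so the entry tends to 0. In the last column the exponent is
    -- 0, and the entry is always 1.
    ...   | yes b<n = ⟶-cong
      (λ t → trans (cong (λ k → (q ^ℚ (t ℕ.+ (s ℕ.+ toℕ a))) ^ℚ k) (ℕ.m+[n∸m]≡n (tall b<n)))
                   (cong (λ x → (q ^ℚ x) ^ℚ l (toℕ b))
                     (trans (sym (ℕ.+-assoc t s (toℕ a))) (cong (ℕ._+ toℕ a) (sym (at-end t a≡n))))))
      refl (⟶-power (s ℕ.+ toℕ a) (l (toℕ b) ∸ 1))
      where a≡n = ℕ.≤-antisym (s≤s⁻¹ (toℕ<n a)) (ℕ.≮⇒≥ a≮n)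
    ...   | no  b≮n = ⟶-const 1ℚ

  summable-tall : ∀ n l → (∀ {a} → a ℕ.< n → 1 ℕ.≤ l a) → Summable n (λ a → l a ∸ 1) → Summable n l
  summable-tall n l tall ih μ |μ| asc = subst (HasSum (Pattern n l μ) wt)
    (*-divQ (q ^ℚ total μ) (alternant q n μ l) (norm n l) (norm≢0 n l))
    (hasSum-layer n n l μ |μ| ℕ.≤-refl (ℕ.n≤1+n n) tall short ih
      (hasSum-by-exhaustion L (λ t → interlacing-unique (μ⁺ t)) (λ t → All.tabulate (λ ν∈ → proj₁ (bounded ν∈)))
        (λ {t} ν∈ → member (suc t) (proj₁ (bounded ν∈)) (λ a → ℕ.m≤n⇒m≤1+n (proj₂ (bounded {t} ν∈) a)))
        -- The total of `ν` bounds each of its entries, in particular the unbounded one.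
        (λ {ν} int → total ν , member (total ν) int (λ a → ℕ.≤-trans (nthD-≤-total ν a) (ℕ.m≤m+n _ _)))
        (⟶-cong
          (λ t → trans (*-comm (1/norm) (alternant q (suc n) (μ⁺ t) (cut n l))) (trans (times-1/norm _)
            (sym (layer-sum n l tall (μ⁺ t) (cut n l) (|μ⁺| t) (ascending t) (λ _ → cut-< l) (cut-self n l)))))
          (trans (*-comm 1/norm (alternant q n μ l)) (times-1/norm _))
          (⟶-* (⟶-const 1/norm) (alternant-limit n l μ |μ| tall (total μ))))))
    where
    short : ∀ {a} → n ℕ.≤ a → a ℕ.< n → l a ≡ 0
    short n≤a a<n = ⊥-elim (ℕ.<⇒≱ a<n n≤a)

    open Exhaustion _≟ᴸ_ (value-nonneg n n l μ |μ| ℕ.≤-refl (ℕ.n≤1+n n) tall short ih) q q>0 q<1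

    -- A constant factor instead of a quotient, so that `⟶-*` applies.
    1/norm : ℚ
    1/norm = divQ 1ℚ (norm n l)

    times-1/norm : ∀ x → x * 1/norm ≡ divQ x (norm n l)
    times-1/norm x = trans (*-divQ x 1ℚ (norm n l) (norm≢0 n l)) (cong (λ y → divQ y (norm n l)) (*-identityʳ x))

    -- Starting from the total of `μ` keeps the extended sequence ascending for every `t`, including
    -- 0.
    μ⁺ : ℕ → List ℕ
    μ⁺ t = μ ++ (t ℕ.+ total μ) ∷ []

    L : ℕ → List (List ℕ)
    L t = interlacing (μ⁺ t)

    |μ⁺| : ∀ t → length (μ⁺ t) ≡ suc n
    |μ⁺| t = trans (length-++ μ) (trans (ℕ.+-comm (length μ) 1) (cong suc |μ|))

    ascending : ∀ t → Ascending (μ⁺ t)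
    ascending t = ascending-++ μ _ asc (λ a → ℕ.≤-trans (nthD-≤-total μ a) (ℕ.m≤n+m _ t))

    μ⁺-< : ∀ t {a} → a ℕ.< n → nthD (μ⁺ t) a ≡ nthD μ a
    μ⁺-< t {a} a<n = nthD-++ˡ μ _ a (subst (a ℕ.<_) (sym |μ|) a<n)

    μ⁺-n : ∀ t → nthD (μ⁺ t) n ≡ t ℕ.+ total μ
    μ⁺-n t = trans (cong (nthD (μ⁺ t)) (sym |μ|)) (nthD-++-last μ _)

    member : ∀ t {ν} → Interlaces n n μ ν → (∀ a → nthD ν a ℕ.≤ t ℕ.+ total μ) → ν ∈ L t
    member t {ν} int ν≤ = ∈-interlacing⁺ (μ⁺ t) ν (|μ⁺| t) (record
      { length≡ = length≡ int
      ; lower = λ a a<n → subst (ℕ._≤ nthD ν a) (sym (μ⁺-< t a<n)) (lower int a a<n)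
      ; upper = λ a a<n _ → upper′ a a<n })
      where
      upper′ : ∀ a → a ℕ.< n → nthD ν a ℕ.≤ nthD (μ⁺ t) (suc a)
      upper′ a a<n with suc a ℕ.<? n
      ... | yes 1+a<n = subst (nthD ν a ℕ.≤_) (sym (μ⁺-< t 1+a<n)) (upper int a a<n 1+a<n)
      ... | no  1+a≮n = subst (nthD ν a ℕ.≤_)
        (sym (trans (cong (nthD (μ⁺ t)) (ℕ.≤-antisym a<n (ℕ.≮⇒≥ 1+a≮n))) (μ⁺-n t))) (ν≤ a)

    bounded : ∀ {t ν} → ν ∈ L t → Interlaces n n μ ν × (∀ a → nthD ν a ℕ.≤ t ℕ.+ total μ)
    bounded {t} {ν} ν∈ = int′ , bound′
      where
      int = ∈-interlacing⁻ (μ⁺ t) (|μ⁺| t) (ascending t) ν∈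

      int′ : Interlaces n n μ ν
      int′ = record
        { length≡ = length≡ int
        ; lower = λ a a<n → subst (ℕ._≤ nthD ν a) (μ⁺-< t a<n) (lower int a a<n)
        ; upper = λ a a<n 1+a<n → subst (nthD ν a ℕ.≤_) (μ⁺-< t 1+a<n) (upper int a a<n (s≤s a<n)) }

      nthD-beyond : ∀ (c : List ℕ) a → length c ℕ.≤ a → nthD c a ≡ 0
      nthD-beyond []      a       _       = refl
      nthD-beyond (x ∷ c) (suc a) (s≤s h) = nthD-beyond c a h

      bound′ : ∀ a → nthD ν a ℕ.≤ t ℕ.+ total μ
      bound′ a with a ℕ.<? n
      ... | no a≮n = subst (ℕ._≤ t ℕ.+ total μ) (sym (nthD-beyond ν a (subst (ℕ._≤ a) (sym (length≡ int)) (ℕ.≮⇒≥ a≮n)))) z≤n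
      ... | yes a<n with suc a ℕ.<? n
      ...   | yes 1+a<n = ℕ.≤-trans (upper int′ a a<n 1+a<n) (ℕ.≤-trans (nthD-≤-total μ (suc a)) (ℕ.m≤n+m _ t))
      ...   | no  1+a≮n = subst (nthD ν a ℕ.≤_)
        (trans (cong (nthD (μ⁺ t)) (ℕ.≤-antisym a<n (ℕ.≮⇒≥ 1+a≮n))) (μ⁺-n t)) (upper int a a<n (s≤s a<n))

  -- Lexicographic induction: if the last exponent `k` is 0, a column is lost and the new last
  -- exponent may be anything; otherwise `n` stays and `k` drops by one.
  summable : ∀ n k l → StrictlyDescending n l → l (n ∸ 1) ≡ k → Summable n l
  summable zero    k       l desc ln = summable-zero l
  summable (suc n) zero    l desc ln = summable-short n l desc ln
    (summable n _ (λ a → l a ∸ 1)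
      (λ a 1+a<n → ℕ.∸-monoˡ-< (desc a (ℕ.m<n⇒m<1+n 1+a<n)) (ℕ.≤-trans (s≤s z≤n) (desc (suc a) (s≤s 1+a<n)))) refl)
  summable (suc n) (suc k) l desc ln = summable-tall (suc n) l tall
    (summable (suc n) k (λ a → l a ∸ 1)
      (λ a 1+a<n → ℕ.∸-monoˡ-< (desc a 1+a<n) (tall 1+a<n)) (cong (_∸ 1) ln))
    where
    tall : ∀ {a} → a ℕ.< suc n → 1 ℕ.≤ l a
    tall {a} a<1+n = ℕ.≤-trans (subst (1 ℕ.≤_) (sym ln) (s≤s z≤n)) (last-least desc (n ∸ a) (ℕ.m∸n+n≡m (s≤s⁻¹ a<1+n)))

-- Patterns in the indexing of the statement

open import Data.Integer using (+_)

nthD-reverse : ∀ c {p} → p ℕ.< length c → nthD (reverse c) p ≡ nthD c (length c ∸ suc p)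
nthD-reverse (x ∷ c) {p} p< rewrite unfold-reverse x c with p ℕ.<? length c
... | yes p<c = trans (nthD-++ˡ (reverse c) _ p (subst (p ℕ.<_) (sym (length-reverse c)) p<c))
  (trans (nthD-reverse c p<c) (cong (nthD (x ∷ c)) (sym (n∸i≡suc p<c))))
... | no  p≮c with refl ← ℕ.≤-antisym (s≤s⁻¹ p<) (ℕ.≮⇒≥ p≮c) = trans
  (cong (nthD (reverse c ++ x ∷ [])) (sym (length-reverse c)))
  (trans (nthD-++-last (reverse c) x) (cong (nthD (x ∷ c)) (sym (ℕ.n∸n≡0 (length c)))))

nthD-ext : ∀ μ ν → length μ ≡ length ν → (∀ a → a ℕ.< length μ → nthD μ a ≡ nthD ν a) → μ ≡ ν
nthD-ext []      []      _ _ = refl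
nthD-ext (x ∷ μ) (y ∷ ν) e h =
  cong₂ _∷_ (h 0 (s≤s z≤n)) (nthD-ext μ ν (ℕ.suc-injective e) (λ a a< → h (suc a) (s≤s a<)))

nthL-reverse : ∀ T a → nthL (map reverse T) a ≡ reverse (nthL T a)
nthL-reverse []      a       = refl
nthL-reverse (c ∷ T) zero    = refl
nthL-reverse (c ∷ T) (suc a) = nthL-reverse T a

reverse-columns-involutive : ∀ (T : List (List ℕ)) → map reverse (map reverse T) ≡ T
reverse-columns-involutive []      = refl
reverse-columns-involutive (c ∷ T) = cong₂ _∷_ (reverse-involutive c) (reverse-columns-involutive T)

total-reverse : ∀ c → total (reverse c) ≡ total c
total-reverse []      = refl
total-reverse (x ∷ c) = trans (cong total (unfold-reverse x c)) (trans (sum-++ (reverse c) (x ∷ []))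
  (trans (cong₂ ℕ._+_ (total-reverse c) (ℕ.+-identityʳ x)) (ℕ.+-comm (total c) x)))

weight-reverse : ∀ T → weight (map reverse T) ≡ weight T
weight-reverse []      = refl
weight-reverse (c ∷ T) = cong₂ ℕ._+_ (total-reverse c) (weight-reverse T)

nthD-applyUpTo : ∀ (f : ℕ → ℕ) {n a} → a ℕ.< n → nthD (applyUpTo f n) a ≡ f a
nthD-applyUpTo f {suc n} {zero}  _       = refl
nthD-applyUpTo f {suc n} {suc a} (s≤s h) = nthD-applyUpTo (λ i → f (suc i)) h

module Coordinates (n : ℕ) (lam mu : ℕ → ℕ) (lam-partition : IsPartition n lam) where

  l : ℕ → ℕ
  l a = lam (suc a) ℕ.+ n ∸ suc a

  -- In reverse order, because the column with index `a` ends on the diagonal in μ_(n-a).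
  μ : List ℕ
  μ = applyUpTo (λ a → mu (n ∸ a)) n

  l-split : ∀ {a} → a ℕ.< n → l a ≡ lam (suc a) ℕ.+ (n ∸ suc a)
  l-split {a} a<n = ℕ.+-∸-assoc (lam (suc a)) a<n

  l-descending : ∀ a → suc a ℕ.< n → l (suc a) ℕ.< l a
  l-descending a 1+a<n = subst₂ ℕ._<_ (sym (l-split 1+a<n)) (sym (l-split (ℕ.<-trans (ℕ.n<1+n a) 1+a<n)))
    (subst (lam (suc (suc a)) ℕ.+ (n ∸ suc (suc a)) ℕ.<_)
      (trans (sym (ℕ.+-suc (lam (suc a)) (n ∸ suc (suc a)))) (cong (lam (suc a) ℕ.+_) (sym (n∸i≡suc 1+a<n))))
      (s≤s (ℕ.+-monoˡ-≤ (n ∸ suc (suc a)) (lam-partition (suc a) (s≤s z≤n) 1+a<n))))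

  |μ| : length μ ≡ n
  |μ| = length-applyUpTo (λ a → mu (n ∸ a)) n

  μ-ascending : IsPartition n mu → Ascending μ
  μ-ascending mu-partition a 1+a< = subst₂ ℕ._≤_
    (sym (trans (nthD-applyUpTo _ (ℕ.<-trans (ℕ.n<1+n a) 1+a<n)) (cong mu (n∸i≡suc (ℕ.<-trans (ℕ.n<1+n a) 1+a<n)))))
    (sym (nthD-applyUpTo _ 1+a<n))
    (mu-partition (n ∸ suc a) (ℕ.m<n⇒0<n∸m 1+a<n)
      (subst (ℕ._≤ n) (n∸i≡suc (ℕ.<-trans (ℕ.n<1+n a) 1+a<n)) (ℕ.m∸n≤m n a)))
    where 1+a<n = subst (suc a ℕ.<_) |μ| 1+a<

  -- The row index i of the p-th cell from the bottom in column a + 1.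
  row : ℕ → ℕ → ℤ
  row a p = + (n ∸ a) ℤ.- + p

  l-ℤ : ∀ {a} → a ℕ.< n → + l a ≡ + (n ∸ a) ℤ.+ + lam (suc a) ℤ.- + 1
  l-ℤ {a} a<n = trans (cong +_ (l-split a<n)) (trans (shift (+ lam (suc a)) (+ (n ∸ suc a)))
    (cong (λ x → + x ℤ.+ + lam (suc a) ℤ.- + 1) (sym (n∸i≡suc a<n))))
    where
    shift : ∀ x r → x ℤ.+ r ≡ (+ 1 ℤ.+ r) ℤ.+ x ℤ.- + 1
    shift = solve-∀ ℤ-ring

  n+1∸suc : ∀ a → n ℕ.+ 1 ∸ suc a ≡ n ∸ a
  n+1∸suc a = cong (_∸ suc a) (ℕ.+-comm n 1)

  row-InIdx : ∀ {a p} → a ℕ.< n → p ℕ.≤ l a → InIdx n lam (row a p) (suc a)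
  row-InIdx {a} {p} a<n p≤l = s≤s z≤n , a<n ,
    ℤ.0≤i-j⇒j≤i (subst (ℤ.0ℤ ℤ.≤_)
      (trans (cong (ℤ._- + p) (l-ℤ a<n)) (rearrange (+ (n ∸ a)) (+ lam (suc a)) (+ p)))
      (ℤ.i≤j⇒0≤j-i (ℤ.+≤+ p≤l))) ,
    subst (λ x → row a p ℤ.≤ + x) (sym (n+1∸suc a)) (ℤ.i-j≤i (+ (n ∸ a)) (+ p))
    where
    rearrange : ∀ m x p → m ℤ.+ x ℤ.- + 1 ℤ.- p ≡ m ℤ.- p ℤ.- (+ 1 ℤ.- x)
    rearrange = solve-∀ ℤ-ring

  InIdx-row : ∀ {a i} → InIdx n lam i (suc a) → ∃ λ p → p ℕ.≤ l a × i ≡ row a p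
  InIdx-row {a} {i} (_ , a<n , lower , upper) = p ,
    ℤ.drop‿+≤+ (ℤ.0≤i-j⇒j≤i (subst (ℤ.0ℤ ℤ.≤_)
      (trans (expand (+ (n ∸ a)) (+ lam (suc a)) i) (cong₂ ℤ._-_ (sym (l-ℤ a<n)) (sym p≡)))
      (ℤ.i≤j⇒0≤j-i lower))) ,
    trans (double (+ (n ∸ a)) i) (cong (λ x → + (n ∸ a) ℤ.- x) (sym p≡))
    where
    p = ℤ.∣ + (n ∸ a) ℤ.- i ∣

    p≡ : + p ≡ + (n ∸ a) ℤ.- i
    p≡ = ℤ.0≤i⇒+∣i∣≡i (ℤ.i≤j⇒0≤j-i (subst (λ x → i ℤ.≤ + x) (n+1∸suc a) upper))

    expand : ∀ m x i → i ℤ.- (+ 1 ℤ.- x) ≡ (m ℤ.+ x ℤ.- + 1) ℤ.- (m ℤ.- i)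
    expand = solve-∀ ℤ-ring

    double : ∀ m i → i ≡ m ℤ.- (m ℤ.- i)
    double = solve-∀ ℤ-ring

  row-injective : ∀ a {p r} → row a p ≡ row a r → p ≡ r
  row-injective a e = ℤ.+-injective (ℤ.neg-injective (ℤ-Group.∙-cancelˡ (+ (n ∸ a)) _ _ e))

  row-below : ∀ a p → row a (suc p) ℤ.+ + 1 ≡ row a p
  row-below a p = step (+ (n ∸ a)) (+ p)
    where
    step : ∀ m p → m ℤ.- (+ 1 ℤ.+ p) ℤ.+ + 1 ≡ m ℤ.- p
    step = solve-∀ ℤ-ring

  row-right : ∀ {a} p → a ℕ.< n → row a (suc p) ≡ row (suc a) p
  row-right {a} p a<n = trans (cong (λ m → + m ℤ.- + suc p) (n∸i≡suc a<n)) (step (+ (n ∸ suc a)) (+ p))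
    where
    step : ∀ m p → + 1 ℤ.+ m ℤ.- (+ 1 ℤ.+ p) ≡ m ℤ.- p
    step = solve-∀ ℤ-ring

  -- The statement stores columns from the top, hence the reversal: the p-th cell from the bottom is
  -- the one at position `l a ∸ p` from the top.
  entry-row : ∀ T {a p} → a ℕ.< n → p ℕ.≤ l a → length (nthL T a) ≡ suc (l a) →
              entry lam T (row a p) (suc a) ≡ cell (map reverse T) a p
  entry-row T {a} {p} a<n p≤l h = sym (trans (cong (λ c → nthD c p) (nthL-reverse T a))
    (trans (nthD-reverse (nthL T a) (subst (p ℕ.<_) (sym h) (s≤s p≤l)))
      (cong (nthD (nthL T a)) (trans (cong (_∸ suc p) h) (cong ℤ.∣_∣ offset)))))
    where
    rearrange : ∀ m x p → m ℤ.+ x ℤ.- + 1 ℤ.- p ≡ m ℤ.- p ℤ.+ x ℤ.- + 1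
    rearrange = solve-∀ ℤ-ring

    offset : + (l a ∸ p) ≡ row a p ℤ.+ + lam (suc a) ℤ.- + 1
    offset = trans (sym (trans (ℤ.[+m]-[+n]≡m⊖n (l a) p) (ℤ.⊖-≥ p≤l)))
      (trans (cong (ℤ._- + p) (l-ℤ a<n)) (rearrange (+ (n ∸ a)) (+ lam (suc a)) (+ p)))

  height≡ : ∀ {a} → a ℕ.< n → (n ∸ suc a) ℕ.+ lam (suc a) ℕ.+ 1 ≡ suc (l a)
  height≡ {a} a<n = trans (ℕ.+-comm _ 1) (cong suc (trans (ℕ.+-comm (n ∸ suc a) (lam (suc a))) (sym (l-split a<n))))

  isGT⇒pattern : ∀ {T} → IsGT n lam mu T → Pattern n l μ (map reverse T)
  isGT⇒pattern {T} (columns , heights , horizontal , vertical , diagonal) = record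
    { columns    = columns′
    ; heights    = λ a a<n → trans (cong length (nthL-reverse T a)) (trans (length-reverse (nthL T a)) (h a<n))
    ; vertical   = λ a p a<n p<l → subst₂ ℕ._≤_
        (trans (cong (λ i → entry lam T i (suc a)) (row-below a p)) (entry-row T a<n (ℕ.<⇒≤ p<l) (h a<n)))
        (entry-row T a<n p<l (h a<n))
        (vertical (row a (suc p)) (suc a) (row-InIdx a<n p<l)
          (subst (λ i → InIdx n lam i (suc a)) (sym (row-below a p)) (row-InIdx a<n (ℕ.<⇒≤ p<l))))
    -- The left neighbour of height p in column a + 1 has height p + 1 in column a; it exists
    -- because `l` is strictly decreasing.
    ; horizontal = λ a p 1+a<n p≤l → let a<n = ℕ.<-trans (ℕ.n<1+n a) 1+a<n
                                         p<l = ℕ.≤-<-trans p≤l (l-descending a 1+a<n) in subst₂ ℕ._≤_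
        (entry-row T a<n p<l (h a<n))
        (trans (cong (λ i → entry lam T i (suc (suc a))) (row-right p a<n)) (entry-row T 1+a<n p≤l (h 1+a<n)))
        (horizontal (row a (suc p)) (suc a) (row-InIdx a<n p<l)
          (subst (λ i → InIdx n lam i (suc (suc a))) (sym (row-right p a<n)) (row-InIdx 1+a<n p≤l)))
    ; base       = nthD-ext (bottom (map reverse T)) μ (trans (trans (length-map _ (map reverse T)) columns′) (sym |μ|))
        (λ a a< → base′ a (subst (a ℕ.<_) (trans (length-map _ (map reverse T)) columns′) a<))
    }
    where
    columns′ : length (map reverse T) ≡ n
    columns′ = trans (length-map reverse T) columns

    h : ∀ {a} → a ℕ.< n → length (nthL T a) ≡ suc (l a)
    h {a} a<n = trans (heights (suc a) (s≤s z≤n) a<n) (height≡ a<n)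

    base′ : ∀ a → a ℕ.< n → nthD (bottom (map reverse T)) a ≡ nthD μ a
    base′ a a<n = trans (nthD-bottom (map reverse T) a) (trans (sym (entry-row T a<n z≤n (h a<n)))
      (trans (cong₂ (entry lam T) (ℤ.+-identityʳ (+ (n ∸ a))) (sym column))
        (trans (diagonal (n ∸ a) (ℕ.m<n⇒0<n∸m a<n) (ℕ.m∸n≤m n a)) (sym (nthD-applyUpTo _ a<n)))))
      where
      column : n ℕ.+ 1 ∸ (n ∸ a) ≡ suc a
      column = trans (cong (_∸ (n ∸ a)) (ℕ.+-comm n 1)) (trans (ℕ.+-∸-assoc 1 (ℕ.m∸n≤m n a))
        (cong suc (ℕ.m∸[m∸n]≡n (ℕ.<⇒≤ a<n))))

  pattern⇒isGT : ∀ {T} → Pattern n l μ (map reverse T) → IsGT n lam mu T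
  pattern⇒isGT {T} pat =
    trans (sym (length-map reverse T)) columns ,
    (λ { (suc a) _ a<n → trans (h a<n) (sym (height≡ a<n)) }) ,
    (λ { i (suc a) idx idx′ → horizontal′ idx idx′ }) ,
    (λ { i (suc a) idx idx′ → vertical′ idx idx′ }) ,
    diagonal
    where
    open Pattern pat

    h : ∀ {a} → a ℕ.< n → length (nthL T a) ≡ suc (l a)
    h {a} a<n = trans (sym (trans (cong length (nthL-reverse T a)) (length-reverse (nthL T a)))) (heights a a<n)

    horizontal′ : ∀ {i a} → InIdx n lam i (suc a) → InIdx n lam i (suc (suc a)) →
                  entry lam T i (suc a) ℕ.≤ entry lam T i (suc (suc a))
    horizontal′ {a = a} idx idx′@(_ , 1+a<n , _) with InIdx-row idx′
    ... | p , p≤l , refl = subst₂ ℕ._≤_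
      (sym (trans (cong (λ i → entry lam T i (suc a)) (sym (row-right p a<n)))
                  (entry-row T a<n (ℕ.≤-<-trans p≤l (l-descending a 1+a<n)) (h a<n))))
      (sym (entry-row T 1+a<n p≤l (h 1+a<n)))
      (horizontal a p 1+a<n p≤l)
      where a<n = ℕ.<-trans (ℕ.n<1+n a) 1+a<n

    vertical′ : ∀ {i a} → InIdx n lam i (suc a) → InIdx n lam (i ℤ.+ + 1) (suc a) →
                entry lam T (i ℤ.+ + 1) (suc a) ℕ.≤ entry lam T i (suc a)
    vertical′ {i} {a} idx@(_ , a<n , _) idx′ with InIdx-row idx | InIdx-row idx′
    ... | p , p≤l , refl | r , r≤l , e
      -- The rows i and i + 1 have heights `p` and `r` from the bottom, so `p` is `suc r`.
      with refl ← row-injective a {p} {suc r} (ℤ-Group.∙-cancelʳ (+ 1) (row a p) (row a (suc r)) (trans e (sym (row-below a r))))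
      = subst₂ ℕ._≤_
        (sym (trans (cong (λ i → entry lam T i (suc a)) e) (entry-row T a<n r≤l (h a<n))))
        (sym (entry-row T a<n p≤l (h a<n)))
        (vertical a r a<n p≤l)

    diagonal : ∀ i → 1 ℕ.≤ i → i ℕ.≤ n → entry lam T (+ i) (n ℕ.+ 1 ∸ i) ≡ mu i
    diagonal i 1≤i i≤n = trans
      (cong₂ (entry lam T) (sym (trans (ℤ.+-identityʳ (+ (n ∸ a))) (cong +_ i≡)))
        (trans (cong (_∸ i) (ℕ.+-comm n 1)) (ℕ.+-∸-assoc 1 i≤n)))
      (trans (entry-row T a<n z≤n (h a<n)) (trans (sym (nthD-bottom (map reverse T) a))
        (trans (cong (λ ν → nthD ν a) base) (trans (nthD-applyUpTo _ a<n) (cong mu i≡)))))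
      where
      a = n ∸ i

      i≡ : n ∸ a ≡ i
      i≡ = ℕ.m∸[m∸n]≡n i≤n

      a<n : a ℕ.< n
      a<n = ℕ.∸-monoʳ-< 1≤i i≤n

-- Closed forms

sgnReverse-square : ∀ n → sgnReverse n * sgnReverse n ≡ 1ℚ
sgnReverse-square zero    = refl
sgnReverse-square (suc n) = trans (regroup (sgn n) (sgnReverse n)) (trans (cong₂ _*_ (sgn-square n) (sgnReverse-square n)) refl)
  where
  regroup : ∀ a b → a * b * (a * b) ≡ (a * a) * (b * b)
  regroup = solve-∀ ring

sgnReverse≢0 : ∀ n → sgnReverse n ≢ 0ℚ
sgnReverse≢0 n e = 1≢0 (trans (sym (sgnReverse-square n)) (trans (cong (_* sgnReverse n) e) (*-zeroˡ (sgnReverse n))))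

*-≢0 : ∀ {a b} → a ≢ 0ℚ → b ≢ 0ℚ → a * b ≢ 0ℚ
*-≢0 {a} {b} a≢0 b≢0 ab≡0 = a≢0 (*-cancelʳ b b≢0 (trans ab≡0 (sym (*-zeroˡ b))))

-- The numerator and the denominator of a Schur polynomial acquire the same reversal sign, which
-- cancels.
divQ-sgnReverse : ∀ n a b → b ≢ 0ℚ → divQ (sgnReverse n * a) (sgnReverse n * b) * b ≡ a
divQ-sgnReverse n a b b≢0 = *-cancelʳ σ (sgnReverse≢0 n) (begin
  divQ (σ * a) (σ * b) * b * σ   ≡⟨ regroup (divQ (σ * a) (σ * b)) b σ ⟩
  divQ (σ * a) (σ * b) * (σ * b) ≡⟨ divQ-* (σ * a) (σ * b) (*-≢0 (sgnReverse≢0 n) b≢0) ⟩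
  σ * a                          ≡⟨ *-comm σ a ⟩
  a * σ                          ∎)
  where
  σ = sgnReverse n

  regroup : ∀ d b s → d * b * s ≡ d * (s * b)
  regroup = solve-∀ ring

prodR-* : ∀ n (f g : ℕ → ℚ) → prodR n (λ i → f i * g i) ≡ prodR n f * prodR n g
prodR-* zero    f g = refl
prodR-* (suc n) f g = trans (cong (_* (f (suc n) * g (suc n))) (prodR-* n f g))
  (interchange (prodR n f) (prodR n g) (f (suc n)) (g (suc n)))
  where
  interchange : ∀ a b c d → a * b * (c * d) ≡ a * c * (b * d)
  interchange = solve-∀ ring

prodR-const : ∀ n c → prodR n (λ _ → c) ≡ c ^ℚ n
prodR-const zero    c = refl
prodR-const (suc n) c = trans (cong (_* c) (prodR-const n c)) (*-comm (c ^ℚ n) c)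

prodR-suc : ∀ n f → prodR (suc n) f ≡ f 1 * prodR n (λ i → f (suc i))
prodR-suc zero    f = *-comm 1ℚ (f 1)
prodR-suc (suc n) f = trans (cong (_* f (suc (suc n))) (prodR-suc n f)) (*-assoc (f 1) _ _)

prodR-reverse : ∀ n f → prodR n (λ i → f (suc n ∸ i)) ≡ prodR n f
prodR-reverse zero    f = refl
prodR-reverse (suc n) f = begin
  prodR n (λ i → f (suc (suc n) ∸ i)) * f (suc n ∸ n)
    ≡⟨ cong₂ _*_ (prodR-cong n (λ i _ i≤n → cong f (ℕ.+-∸-assoc 1 (ℕ.m≤n⇒m≤1+n i≤n)))) (cong f (ℕ.m+n∸n≡m 1 n)) ⟩
  prodR n (λ i → f (suc (suc n ∸ i))) * f 1
    ≡⟨ cong (_* f 1) (prodR-reverse n (λ i → f (suc i))) ⟩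
  prodR n (λ i → f (suc i)) * f 1
    ≡⟨ *-comm _ (f 1) ⟩
  f 1 * prodR n (λ i → f (suc i))
    ≡⟨ prodR-suc n f ⟨
  prodR (suc n) f ∎

prodR-divQ : ∀ n f g → (∀ j → g j ≢ 0ℚ) → prodR n (λ j → divQ (f j) (g j)) * prodR n g ≡ prodR n f
prodR-divQ n f g g≢0 = trans (sym (prodR-* n (λ j → divQ (f j) (g j)) g))
  (prodR-cong n (λ j _ _ → divQ-* (f j) (g j) (g≢0 j)))

prodR-^ : ∀ q n (f : ℕ → ℕ) → prodR n (λ i → q ^ℚ f i) ≡ q ^ℚ sumN n f
prodR-^ q zero    f = refl
prodR-^ q (suc n) f = trans (cong (_* q ^ℚ f (suc n)) (prodR-^ q n f)) (sym (^-+ q (sumN n f) (f (suc n))))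

bStat-addSeq : ∀ n f g → bStat n (addSeq f g) ≡ bStat n f ℕ.+ bStat n g
bStat-addSeq zero    f g = refl
bStat-addSeq (suc n) f g = trans (cong₂ ℕ._+_ (bStat-addSeq n f g) (ℕ.*-distribˡ-+ n (f (suc n)) (g (suc n))))
  (interchange (bStat n f) (bStat n g) (n ℕ.* f (suc n)) (n ℕ.* g (suc n)))
  where
  interchange : ∀ a b c d → a ℕ.+ b ℕ.+ (c ℕ.+ d) ≡ a ℕ.+ c ℕ.+ (b ℕ.+ d)
  interchange = solve-∀ ℕ-ring

total-applyUpTo : ∀ n (f : ℕ → ℕ) → total (applyUpTo (λ a → f (n ∸ a)) n) ≡ size n f
total-applyUpTo zero    f = refl
total-applyUpTo (suc n) f = trans (cong (f (suc n) ℕ.+_) (total-applyUpTo n f)) (ℕ.+-comm (f (suc n)) (size n f))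

powZ-neg : ∀ q → q ≢ 0ℚ → ∀ k → powZ q (ℤ.- + k) * q ^ℚ k ≡ 1ℚ
powZ-neg q q≢0 zero    = refl
powZ-neg q q≢0 (suc k) = divQ-* 1ℚ (q ^ℚ suc k) (pow≢0 (suc k))
  where
  pow≢0 : ∀ k → q ^ℚ k ≢ 0ℚ
  pow≢0 zero    = 1≢0
  pow≢0 (suc k) = *-≢0 q≢0 (pow≢0 k)

-- Clears the possibly negative exponent, so that the closed forms are compared through natural
-- powers only.
powZ-difference : ∀ q → q ≢ 0ℚ → ∀ s b → powZ q (+ s ℤ.- + b) * q ^ℚ b ≡ q ^ℚ s
powZ-difference q q≢0 s b with ℕ.≤-total b s
... | inj₁ b≤s = begin
  powZ q (+ s ℤ.- + b) * q ^ℚ b ≡⟨ cong (λ i → powZ q i * q ^ℚ b) (trans (ℤ.[+m]-[+n]≡m⊖n s b) (ℤ.⊖-≥ b≤s)) ⟩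
  q ^ℚ (s ∸ b) * q ^ℚ b         ≡⟨ ^-+ q (s ∸ b) b ⟨
  q ^ℚ (s ∸ b ℕ.+ b)            ≡⟨ cong (q ^ℚ_) (ℕ.m∸n+n≡m b≤s) ⟩
  q ^ℚ s                        ∎
... | inj₂ s≤b = begin
  powZ q (+ s ℤ.- + b) * q ^ℚ b
    ≡⟨ cong₂ (λ i k → powZ q i * q ^ℚ k) (trans (ℤ.[+m]-[+n]≡m⊖n s b) (ℤ.⊖-≤ s≤b)) (sym (ℕ.m∸n+n≡m s≤b)) ⟩
  powZ q (ℤ.- + (b ∸ s)) * q ^ℚ (b ∸ s ℕ.+ s)
    ≡⟨ cong (powZ q (ℤ.- + (b ∸ s)) *_) (^-+ q (b ∸ s) s) ⟩
  powZ q (ℤ.- + (b ∸ s)) * (q ^ℚ (b ∸ s) * q ^ℚ s)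
    ≡⟨ *-assoc (powZ q (ℤ.- + (b ∸ s))) (q ^ℚ (b ∸ s)) (q ^ℚ s) ⟨
  powZ q (ℤ.- + (b ∸ s)) * q ^ℚ (b ∸ s) * q ^ℚ s
    ≡⟨ cong (_* q ^ℚ s) (powZ-neg q q≢0 (b ∸ s)) ⟩
  1ℚ * q ^ℚ s
    ≡⟨ *-identityˡ _ ⟩
  q ^ℚ s ∎

module ClosedForms (q : ℚ) (q>0 : 0ℚ < q) (q<1 : q < 1ℚ) (n : ℕ) (lam mu : ℕ → ℕ)
                   (lam-partition : IsPartition n lam) (mu-partition : IsPartition n mu) where
  open PatternSum q q>0 q<1
  open Coordinates n lam mu lam-partition

  q≢0 : q ≢ 0ℚ
  q≢0 = pos⇒≢0 q>0

  X Y : ℕ → ℚ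
  X = qPow q (addSeq mu (delta n))
  Y = qPow q (delta n)

  A D v F : ℚ
  A = alternant q n μ l
  D = prodR n (λ j → qPoch q (lam j ℕ.+ n ∸ j))
  v = vandBar n X
  F = prodR n (λ j → qPoch q (n ∸ j))

  s b b₀ : ℕ
  s  = size n mu
  b  = bStat n (addSeq (delta n) lam)
  b₀ = bStat n (delta n)

  difference-pos : ∀ {i j} → j ℕ.< i → 0ℚ < q ^ℚ j - q ^ℚ i
  difference-pos {i} {j} j<i = subst (0ℚ <_) (begin
    q ^ℚ j * (1ℚ - q ^ℚ (i ∸ j))      ≡⟨ expand (q ^ℚ j) (q ^ℚ (i ∸ j)) ⟩
    q ^ℚ j - q ^ℚ j * q ^ℚ (i ∸ j)    ≡⟨ cong (λ x → q ^ℚ j - x) (^-+ q j (i ∸ j)) ⟨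
    q ^ℚ j - q ^ℚ (j ℕ.+ (i ∸ j))     ≡⟨ cong (λ k → q ^ℚ j - q ^ℚ k) (ℕ.m+[n∸m]≡n (ℕ.<⇒≤ j<i)) ⟩
    q ^ℚ j - q ^ℚ i                   ∎)
    (*-pos (^-pos q>0 j) (1-q^>0 (ℕ.m<n⇒0<n∸m j<i)))
    where
    expand : ∀ a c → a * (1ℚ - c) ≡ a - a * c
    expand = solve-∀ ring

  antitone : ∀ d {i} → 1 ℕ.≤ i → d ℕ.+ i ℕ.≤ n → mu (d ℕ.+ i) ℕ.≤ mu i
  antitone zero    1≤i _    = ℕ.≤-refl
  antitone (suc d) {i} 1≤i d+i<n = ℕ.≤-trans (mu-partition (d ℕ.+ i) (ℕ.≤-trans 1≤i (ℕ.m≤n+m i d)) d+i<n)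
                                         (antitone d 1≤i (ℕ.<⇒≤ d+i<n))

  -- The exponents μ_i + n - i strictly decrease, so the powers of `q` < 1 strictly increase.
  v>0 : 0ℚ < v
  v>0 = prodR-pos n (λ j 1≤j j≤n → prodR-pos (j ∸ 1) (λ i 1≤i i≤j-1 →
    let i<j = subst (i ℕ.<_) (ℕ.m+[n∸m]≡n 1≤j) (s≤s i≤j-1) in
    difference-pos (ℕ.+-mono-≤-< (weaken i<j 1≤i j≤n) (ℕ.∸-monoʳ-< i<j j≤n))))
    where
    weaken : ∀ {i j} → i ℕ.< j → 1 ℕ.≤ i → j ℕ.≤ n → mu j ℕ.≤ mu i
    weaken {i} {j} i<j 1≤i j≤n = subst (λ k → mu k ℕ.≤ mu i) d+i≡j
      (antitone (j ∸ i) 1≤i (subst (ℕ._≤ n) (sym d+i≡j) j≤n))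
      where d+i≡j = ℕ.m∸n+n≡m (ℕ.<⇒≤ i<j)

  vY>0 : 0ℚ < vandBar n Y
  vY>0 = prodR-pos n (λ j 1≤j j≤n → prodR-pos (j ∸ 1) (λ i 1≤i i≤j-1 →
    difference-pos (ℕ.∸-monoʳ-< (subst (i ℕ.<_) (ℕ.m+[n∸m]≡n 1≤j) (s≤s i≤j-1)) j≤n)))

  -- The differences are q^(n-j) (1 - q^(j-i)). For fixed j they multiply to q^((j-1)(n-j))
  -- (q;q)_(j-1), and the exponents add up to b(δ).
  vY-factor : vandBar n Y ≡ q ^ℚ b₀ * F
  vY-factor = begin
    vandBar n Y
      ≡⟨ prodR-cong n row-product ⟩
    prodR n (λ j → q ^ℚ ((j ∸ 1) ℕ.* delta n j) * qPoch q (j ∸ 1))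
      ≡⟨ prodR-* n (λ j → q ^ℚ ((j ∸ 1) ℕ.* delta n j)) (λ j → qPoch q (j ∸ 1)) ⟩
    prodR n (λ j → q ^ℚ ((j ∸ 1) ℕ.* delta n j)) * prodR n (λ j → qPoch q (j ∸ 1))
      ≡⟨ cong₂ _*_ (prodR-^ q n (λ j → (j ∸ 1) ℕ.* delta n j)) (begin
           prodR n (λ j → qPoch q (j ∸ 1))         ≡⟨ prodR-reverse n (λ j → qPoch q (j ∸ 1)) ⟨
           prodR n (λ j → qPoch q (suc n ∸ j ∸ 1)) ≡⟨ prodR-cong n (λ j _ _ → cong (qPoch q)
               (trans (ℕ.∸-+-assoc (suc n) j 1) (cong (suc n ∸_) (ℕ.+-comm j 1)))) ⟩
           F                                       ∎) ⟩
    q ^ℚ b₀ * F ∎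
    where
    row-product : ∀ j → 1 ℕ.≤ j → j ℕ.≤ n →
      prodR (j ∸ 1) (λ i → Y j - Y i) ≡ q ^ℚ ((j ∸ 1) ℕ.* delta n j) * qPoch q (j ∸ 1)
    row-product (suc k) _ j≤n = begin
      prodR k (λ i → Y (suc k) - Y i)
        ≡⟨ prodR-cong k (λ i _ i≤k → trans
             (cong (λ e → Y (suc k) - q ^ℚ e) (split i (ℕ.≤-trans i≤k (ℕ.n≤1+n k))))
             (trans (cong (λ p → Y (suc k) - p) (^-+ q (n ∸ suc k) (suc k ∸ i)))
                    (factor (Y (suc k)) (q ^ℚ (suc k ∸ i))))) ⟩
      prodR k (λ i → Y (suc k) * (1ℚ - q ^ℚ (suc k ∸ i)))
        ≡⟨ prodR-* k (λ _ → Y (suc k)) (λ i → 1ℚ - q ^ℚ (suc k ∸ i)) ⟩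
      prodR k (λ _ → Y (suc k)) * prodR k (λ i → 1ℚ - q ^ℚ (suc k ∸ i))
        ≡⟨ cong₂ _*_ (trans (prodR-const k (Y (suc k))) (^-* q (n ∸ suc k) k)) (prodR-reverse k (λ i → 1ℚ - q ^ℚ i)) ⟩
      q ^ℚ (k ℕ.* delta n (suc k)) * qPoch q k ∎
      where
      split : ∀ i → i ℕ.≤ suc k → n ∸ i ≡ n ∸ suc k ℕ.+ (suc k ∸ i)
      split i i≤j = trans (cong (_∸ i) (sym (ℕ.m∸n+n≡m j≤n))) (ℕ.+-∸-assoc (n ∸ suc k) i≤j)

      factor : ∀ y p → y - y * p ≡ y * (1ℚ - p)
      factor = solve-∀ ring

  exponent : ∀ {i} → i ℕ.< n → mu (suc i) ℕ.+ n ∸ suc i ≡ addSeq mu (delta n) (suc i)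
  exponent {i} i<n = ℕ.+-∸-assoc (mu (suc i)) i<n

  -- With a = j - 1 the exponents a l_a are the summands of b(δ + λ).
  norm-factor : norm n l ≡ q ^ℚ b * D
  norm-factor = begin
    norm n l
      ≡⟨ prod-distrib-* {n} (λ a → (q ^ℚ toℕ a) ^ℚ l (toℕ a)) (λ a → qPoch q (l (toℕ a))) ⟩
    prod {n} (λ a → (q ^ℚ toℕ a) ^ℚ l (toℕ a)) * prod {n} (λ a → qPoch q (l (toℕ a)))
      ≡⟨ cong₂ _*_ (trans
           (prod-cong {n} (λ a → trans (^-* q (toℕ a) (l (toℕ a))) (cong (q ^ℚ_) (trans (ℕ.*-comm (l (toℕ a)) (toℕ a))
             (cong (toℕ a ℕ.*_) (trans (l-split (toℕ<n a)) (ℕ.+-comm (lam (suc (toℕ a))) (n ∸ suc (toℕ a)))))))))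
           (trans (sym (prodR-prod n (λ j → q ^ℚ ((j ∸ 1) ℕ.* addSeq (delta n) lam j))))
                  (prodR-^ q n (λ j → (j ∸ 1) ℕ.* addSeq (delta n) lam j))))
           (sym (prodR-prod n (λ j → qPoch q (lam j ℕ.+ n ∸ j)))) ⟩
    q ^ℚ b * D ∎

  -- Transposition and reversal of the rows lead from one determinant to the other. The square of
  -- the sign is inserted so that one copy is absorbed by the reversal and the other remains.
  numerator : det n (λ i j → X (suc (toℕ j)) ^ℚ (lam (suc (toℕ i)) ℕ.+ n ∸ suc (toℕ i))) ≡ sgnReverse n * A
  numerator = begin
    N
      ≡⟨ *-identityˡ N ⟨
    1ℚ * N
      ≡⟨ cong (_* N) (sgnReverse-square n) ⟨
    sgnReverse n * sgnReverse n * N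
      ≡⟨ *-assoc (sgnReverse n) (sgnReverse n) N ⟩
    sgnReverse n * (sgnReverse n * N)
      ≡⟨ cong (λ x → sgnReverse n * (sgnReverse n * x)) (det-transpose M) ⟨
    sgnReverse n * (sgnReverse n * det n (λ i j → M j i))
      ≡⟨ cong (sgnReverse n *_) (det-reverse (λ i j → M j i)) ⟨
    sgnReverse n * det n (λ i j → M j (opposite i))
      ≡⟨ cong (sgnReverse n *_) (det-cong (λ i j → cong (_^ℚ l (toℕ j)) (cong (q ^ℚ_) (base≡ i)))) ⟩
    sgnReverse n * A ∎
    where
    M : Matrix n
    M i j = X (suc (toℕ j)) ^ℚ l (toℕ i)

    N = det n M

    base≡ : ∀ (i : Fin n) → addSeq mu (delta n) (suc (toℕ (opposite i))) ≡ nthD μ (toℕ i) ℕ.+ toℕ i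
    base≡ i = trans
      (cong (addSeq mu (delta n)) (trans (cong suc (opposite-prop i)) (sym (n∸i≡suc (toℕ<n i)))))
      (cong₂ ℕ._+_ (sym (nthD-applyUpTo _ (toℕ<n i))) (ℕ.m∸[m∸n]≡n (ℕ.<⇒≤ (toℕ<n i))))

  schur-lam : schur n lam X * v ≡ A
  schur-lam = trans (cong (_* v) (cong₂ divQ numerator (vandermonde n X))) (divQ-sgnReverse n A v (pos⇒≢0 v>0))

  -- At powers of `q` the numerator of s_μ(q^δ) has the entries q^((n-i)(μ_j+n-j)), up to
  -- transposition. Read with q^(μ+δ) as the variables, it is a Vandermonde determinant.
  schur-mu : schur n mu Y * vandBar n Y ≡ v
  schur-mu = trans (cong (_* vandBar n Y) (cong₂ divQ numerator-mu (vandermonde n Y)))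
                   (divQ-sgnReverse n v (vandBar n Y) (pos⇒≢0 vY>0))
    where
    numerator-mu : det n (λ i j → Y (suc (toℕ j)) ^ℚ (mu (suc (toℕ i)) ℕ.+ n ∸ suc (toℕ i))) ≡ sgnReverse n * v
    numerator-mu = begin
      det n (λ i j → Y (suc (toℕ j)) ^ℚ (mu (suc (toℕ i)) ℕ.+ n ∸ suc (toℕ i)))
        ≡⟨ det-transpose {n} (λ i j → Y (suc (toℕ j)) ^ℚ (mu (suc (toℕ i)) ℕ.+ n ∸ suc (toℕ i))) ⟨
      det n (λ i j → Y (suc (toℕ i)) ^ℚ (mu (suc (toℕ j)) ℕ.+ n ∸ suc (toℕ j)))
        ≡⟨ det-cong (λ i j → trans (cong (Y (suc (toℕ i)) ^ℚ_) (exponent (toℕ<n j)))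
             (^-swap q (n ∸ suc (toℕ i)) (addSeq mu (delta n) (suc (toℕ j))))) ⟩
      det n (λ i j → X (suc (toℕ j)) ^ℚ (n ∸ suc (toℕ i)))
        ≡⟨ vandermonde n X ⟩
      sgnReverse n * v ∎

  D≢0 : D ≢ 0ℚ
  D≢0 = pos⇒≢0 (prodR-pos n (λ j _ _ → qPoch-pos (lam j ℕ.+ n ∸ j)))

  -- Reduces both closed forms to an identity without denominators.
  is-value : ∀ x → x * (q ^ℚ b * D) ≡ q ^ℚ s * A → value n l μ ≡ x
  is-value x e = sym (divQ-unique (q ^ℚ total μ * A) (norm n l) (norm≢0 n l)
    (trans (cong (x *_) norm-factor) (trans e (cong (λ k → q ^ℚ k * A) (sym (total-applyUpTo n mu))))))

  value≡rhs2 : value n l μ ≡ rhs2 q n lam mu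
  value≡rhs2 = is-value (rhs2 q n lam mu) (begin
    divQ P D * S * v * (q ^ℚ b * D)     ≡⟨ regroup (divQ P D) S v (q ^ℚ b) D ⟩
    divQ P D * D * q ^ℚ b * (S * v)     ≡⟨ cong₂ (λ x y → x * q ^ℚ b * y) (divQ-* P D D≢0) schur-lam ⟩
    P * q ^ℚ b * A                      ≡⟨ cong (_* A) (powZ-difference q q≢0 s b) ⟩
    q ^ℚ s * A                          ∎)
    where
    P = powZ q (+ s ℤ.- + b)
    S = schur n lam X

    regroup : ∀ p S v c d → p * S * v * (c * d) ≡ p * d * c * (S * v)
    regroup = solve-∀ ring

  value≡rhs1 : value n l μ ≡ rhs1 q n lam mu
  value≡rhs1 = is-value (rhs1 q n lam mu) (begin
    P * Sμ * Sλ * Q * (q ^ℚ b * D)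
      ≡⟨ cong (λ c → P * Sμ * Sλ * Q * (c * D)) (trans (cong (q ^ℚ_) (bStat-addSeq n (delta n) lam)) (^-+ q b₀ b₁)) ⟩
    P * Sμ * Sλ * Q * (q ^ℚ b₀ * q ^ℚ b₁ * D)
      ≡⟨ regroup P Sμ Sλ Q (q ^ℚ b₀) (q ^ℚ b₁) D ⟩
    P * q ^ℚ b₁ * (Sλ * (Sμ * (q ^ℚ b₀ * (Q * D))))
      ≡⟨ cong₂ (λ x y → x * (Sλ * (Sμ * (q ^ℚ b₀ * y)))) (powZ-difference q q≢0 s b₁)
           (prodR-divQ n (λ j → qPoch q (n ∸ j)) (λ j → qPoch q (lam j ℕ.+ n ∸ j))
             (λ j → pos⇒≢0 (qPoch-pos (lam j ℕ.+ n ∸ j)))) ⟩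
    q ^ℚ s * (Sλ * (Sμ * (q ^ℚ b₀ * F)))
      ≡⟨ cong (λ x → q ^ℚ s * (Sλ * x)) (trans (cong (Sμ *_) (sym vY-factor)) schur-mu) ⟩
    q ^ℚ s * (Sλ * v)
      ≡⟨ cong (q ^ℚ s *_) schur-lam ⟩
    q ^ℚ s * A ∎)
    where
    b₁ = bStat n lam
    P  = powZ q (+ s ℤ.- + b₁)
    Sμ = schur n mu Y
    Sλ = schur n lam X
    Q  = prodR n (λ j → divQ (qPoch q (n ∸ j)) (qPoch q (lam j ℕ.+ n ∸ j)))

    regroup : ∀ P m l Q x y D → P * m * l * Q * (x * y * D) ≡ P * y * (l * (m * (x * (Q * D))))
    regroup = solve-∀ ring

  sumGT : SumGT q n lam mu (value n l μ)
  sumGT = subst (HasSum (IsGT n lam mu) wt) (*-identityˡ (value n l μ))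
    -- Only the storage order of the columns changes, which preserves the weight.
    (hasSum-transport 1ℚ (positive⁻¹ 1ℚ) ≤-refl (map reverse) (map reverse)
      (λ {T} pat → pattern⇒isGT (subst (Pattern n l μ) (sym (reverse-columns-involutive T)) pat))
      isGT⇒pattern
      (λ {T} _ → reverse-columns-involutive T) (λ {T} _ → reverse-columns-involutive T)
      (λ {T} _ → trans (cong (q ^ℚ_) (weight-reverse T)) (sym (*-identityˡ (wt T))))
      (summable n (l (n ∸ 1)) l l-descending refl μ |μ| (μ-ascending mu-partition)))

theorem8p10 : (q : ℚ) → 0ℚ < q → q < 1ℚ → (n : ℕ) → 1 ℕ.≤ n →
    (lam mu : ℕ → ℕ) → IsPartition n lam → IsPartition n mu →
    SumGT q n lam mu (rhs1 q n lam mu) × SumGT q n lam mu (rhs2 q n lam mu)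
theorem8p10 q q>0 q<1 n 1≤n lam mu lam-partition mu-partition =
  subst (SumGT q n lam mu) value≡rhs1 sumGT , subst (SumGT q n lam mu) value≡rhs2 sumGT
  where open ClosedForms q q>0 q<1 n lam mu lam-partition mu-partition
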